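{- Let $p$ be an odd prime, let $S=\{q_1,q_2,q_3\}$ be a set of three primes with $q_i\equiv 1 \pmod p$ and $q_i\not\equiv 1\pmod{p^2}$, and let $n<p$. Then $\mathfrak l_S$ fails to have Property $FM(n)$ if and only if $\ell_{ij}\ne 0$ for all $i\ne j$ and $$\ell_{13}/c_1=-\ell_{23}/c_2,\qquad \ell_{21}/c_2=-\ell_{31}/c_3,\qquad \ell_{12}/c_1=-\ell_{32}/c_3 .$$
   Context: $c_i=(q_i-1)/p \bmod p\in\mathbb{F}_p^\times$; for $i\ne j$, choosing a primitive root $g_j$ mod $q_j$, the linking number $\ell_{ij}\in\mathbb{F}_p$ is defined by $q_i\equiv g_j^{ -\ell_{ij}}\pmod{q_j}$. The linking algebra $\mathfrak l_S$ is the Lie algebra over $\mathbb{F}_p$ generated by $\xi_1,\xi_2,\xi_3$ with relations $c_i\xi_i+\sum_{j\ne i}\ell_{ij}[\xi_i,\xi_j]=0$, $i=1,2,3$. A Lie algebra $\mathfrak g$ over a field $F$ has Property $FM(n)$ if every Lie algebra homomorphism $\mathfrak g\to\mathfrak{gl}_n(F)$ is zero.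
   Formalization: The formal theorem assumes 2 ≤ n < p instead of n < p: for n ≤ 1 Property FM(n) always holds, so the equivalence fails whenever the linking conditions hold, for example for p = 3, S = {7, 67, 103}, n = 1. -}

module Defs where

open import Data.Nat as ℕ using (ℕ; zero; suc)
open import Data.Integer as ℤ using (ℤ; +_; _+_; _-_; _*_; -_; 0ℤ; 1ℤ)
open import Data.Integer.Divisibility as ℤD using ()
open import Data.Fin using (Fin; zero; suc)
open import Data.Fin.Properties using (_≟_)
open import Data.Product using (_×_)
open import Relation.Nullary using (¬_; yes; no)

infix 4 _≡_[mod_] _≡ℕ_[mod_] _≈ₘ_[mod_]
infixl 6 _+ₘ_ _-ₘ_
infixl 7 _*ₘ_ _·ₘ_

_≡_[mod_] : ℤ → ℤ → ℕ → Set
a ≡ b [mod m ] = (+ m) ℤD.∣ (a - b)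

_≡ℕ_[mod_] : ℕ → ℕ → ℕ → Set
a ≡ℕ b [mod m ] = (+ a) ≡ (+ b) [mod m ]

IsPrimitiveRoot : ℕ → ℕ → Set
IsPrimitiveRoot q g =
  (g ℕ.^ (q ℕ.∸ 1) ≡ℕ 1 [mod q ]) ×
  (∀ k → 0 ℕ.< k → k ℕ.< q ℕ.∸ 1 → ¬ (g ℕ.^ k ≡ℕ 1 [mod q ]))

-- Matrices over F_p (integer entries, compared modulo p): gl_n(F_p)

Mat : ℕ → Set
Mat n = Fin n → Fin n → ℤ

ΣFin : ∀ n → (Fin n → ℤ) → ℤ
ΣFin zero    f = 0ℤ
ΣFin (suc n) f = f zero + ΣFin n (λ i → f (suc i))

0ₘ : ∀ {n} → Mat n
0ₘ i j = 0ℤ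

_+ₘ_ : ∀ {n} → Mat n → Mat n → Mat n
(A +ₘ B) i j = A i j + B i j

_-ₘ_ : ∀ {n} → Mat n → Mat n → Mat n
(A -ₘ B) i j = A i j - B i j

_·ₘ_ : ∀ {n} → ℤ → Mat n → Mat n
(a ·ₘ A) i j = a * A i j

_*ₘ_ : ∀ {n} → Mat n → Mat n → Mat n
_*ₘ_ {n} A B i j = ΣFin n (λ k → A i k * B k j)

⁅_,_⁆ₘ : ∀ {n} → Mat n → Mat n → Mat n
⁅ A , B ⁆ₘ = (A *ₘ B) -ₘ (B *ₘ A)

_≈ₘ_[mod_] : ∀ {n} → Mat n → Mat n → ℕ → Set
A ≈ₘ B [mod p ] = ∀ i j → A i j ≡ B i j [mod p ]

-- The linking algebra l_S: Lie algebra over F_p presented by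
-- generators ξ₁ ξ₂ ξ₃ and relations c_i ξ_i + Σ_{j≠i} ℓ_ij [ξ_i, ξ_j] = 0.
-- Realised as formal terms modulo the congruence generated by the
-- F_p-Lie-algebra axioms and the defining relations.

infixl 6 _⊕_
infixr 7 _⊙_

data LTerm : Set where
  ξ    : Fin 3 → LTerm
  𝟘    : LTerm
  _⊕_  : LTerm → LTerm → LTerm
  _⊙_  : ℤ → LTerm → LTerm
  ⟦_,_⟧ : LTerm → LTerm → LTerm

Σ₃ : (Fin 3 → LTerm) → LTerm
Σ₃ f = f zero ⊕ f (suc zero) ⊕ f (suc (suc zero))

linkRel : (c : Fin 3 → ℤ) (ℓ : Fin 3 → Fin 3 → ℤ) → Fin 3 → LTerm
linkRel c ℓ i = c i ⊙ ξ i ⊕ Σ₃ (λ j → term j)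
  where
  term : Fin 3 → LTerm
  term j with i ≟ j
  ... | yes _ = 𝟘
  ... | no  _ = ℓ i j ⊙ ⟦ ξ i , ξ j ⟧

module LinkingAlgebra (p : ℕ) (c : Fin 3 → ℤ) (ℓ : Fin 3 → Fin 3 → ℤ) where

  infix 4 _≈_

  data _≈_ : LTerm → LTerm → Set where
    refl  : ∀ {x} → x ≈ x
    sym   : ∀ {x y} → x ≈ y → y ≈ x
    trans : ∀ {x y z} → x ≈ y → y ≈ z → x ≈ z
    ⊕-cong : ∀ {x x' y y'} → x ≈ x' → y ≈ y' → x ⊕ y ≈ x' ⊕ y'
    ⊙-cong : ∀ {a b x y} → a ≡ b [mod p ] → x ≈ y → a ⊙ x ≈ b ⊙ y
    br-cong : ∀ {x x' y y'} → x ≈ x' → y ≈ y' → ⟦ x , y ⟧ ≈ ⟦ x' , y' ⟧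
    ⊕-assoc : ∀ x y z → (x ⊕ y) ⊕ z ≈ x ⊕ (y ⊕ z)
    ⊕-comm  : ∀ x y → x ⊕ y ≈ y ⊕ x
    ⊕-idʳ   : ∀ x → x ⊕ 𝟘 ≈ x
    ⊕-invʳ  : ∀ x → x ⊕ (- 1ℤ) ⊙ x ≈ 𝟘
    ⊙-one   : ∀ x → 1ℤ ⊙ x ≈ x
    ⊙-assoc : ∀ a b x → (a * b) ⊙ x ≈ a ⊙ (b ⊙ x)
    ⊙-distribʳ : ∀ a b x → (a + b) ⊙ x ≈ a ⊙ x ⊕ b ⊙ x
    ⊙-distribˡ : ∀ a x y → a ⊙ (x ⊕ y) ≈ a ⊙ x ⊕ a ⊙ y
    br-⊕ˡ : ∀ x y z → ⟦ x ⊕ y , z ⟧ ≈ ⟦ x , z ⟧ ⊕ ⟦ y , z ⟧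
    br-⊕ʳ : ∀ x y z → ⟦ x , y ⊕ z ⟧ ≈ ⟦ x , y ⟧ ⊕ ⟦ x , z ⟧
    br-⊙ˡ : ∀ a x y → ⟦ a ⊙ x , y ⟧ ≈ a ⊙ ⟦ x , y ⟧
    br-⊙ʳ : ∀ a x y → ⟦ x , a ⊙ y ⟧ ≈ a ⊙ ⟦ x , y ⟧
    br-alt : ∀ x → ⟦ x , x ⟧ ≈ 𝟘
    jacobi : ∀ x y z →
      ⟦ x , ⟦ y , z ⟧ ⟧ ⊕ ⟦ y , ⟦ z , x ⟧ ⟧ ⊕ ⟦ z , ⟦ x , y ⟧ ⟧ ≈ 𝟘
    rel : ∀ i → linkRel c ℓ i ≈ 𝟘

  record IsLieHom (n : ℕ) (φ : LTerm → Mat n) : Set where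
    field
      resp  : ∀ {x y} → x ≈ y → φ x ≈ₘ φ y [mod p ]
      hom-⊕ : ∀ x y → φ (x ⊕ y) ≈ₘ (φ x +ₘ φ y) [mod p ]
      hom-⊙ : ∀ a x → φ (a ⊙ x) ≈ₘ (a ·ₘ φ x) [mod p ]
      hom-br : ∀ x y → φ ⟦ x , y ⟧ ≈ₘ ⁅ φ x , φ y ⁆ₘ [mod p ]

  FM : ℕ → Set
  FM n = ∀ (φ : LTerm → Mat n) → IsLieHom n φ → ∀ x → φ x ≈ₘ 0ₘ [mod p ]

{-# OPTIONS --safe #-}
module Submission where

-- Put P = ([ξ₂,ξ₃], [ξ₃,ξ₁], [ξ₁,ξ₂]). The relations read cᵢ ξᵢ = Σ Mᵢₖ Pₖ with M built from
-- the linking numbers. A nontrivial linear relation among the ξᵢ, bracketed with each ξⱼ,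
-- makes P proportional to its coefficient vector; then all ξᵢ are collinear, so they commute
-- and vanish. Hence, if the algebra is nonzero, the ξᵢ are independent. This forces
-- det M ≠ 0, since otherwise the rows of adj M give relations, so adj M = 0 and some row of
-- M vanishes. Now det M · Pₖ = Σ (adj M)ₖᵢ cᵢ ξᵢ, and the Jacobi identity
-- Σ [ξᵢ,Pᵢ] = 0 says that the matrix (adj M) diag(c) is symmetric. Equivalently
-- diag(c)⁻¹ M is symmetric, which is the system of three equations; together with
-- det M ≠ 0 it makes every ℓᵢⱼ nonzero. Conversely, under these conditions the relations
-- are solved explicitly by matrices in sl₂.

open import Defs
open import Algebra.Bundles using (CommutativeSemigroup)
import Algebra.Properties.CommutativeSemigroup as CommutativeSemigroupProperties
open import Data.Nat using (ℕ; zero; suc; _≤_; _<_; _∸_; _^_)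
import Data.Nat as ℕ
import Data.Nat.Properties as ℕ
import Data.Nat.Divisibility as ℕD
open import Data.Nat.Coprimality using (Coprime; coprime-Bézout)
open import Data.Nat.Divisibility using (_∣_)
open import Data.Nat.GCD using (module Bézout)
open import Data.Nat.Primality using (Prime; irreducible[2]; prime⇒irreducible; prime⇒nonTrivial)
open import Data.Integer as ℤ using (ℤ; +_; -[1+_]; -_; _+_; _-_; _*_; 0ℤ; 1ℤ)
import Data.Integer.Properties as ℤ
import Data.Integer.Divisibility.Signed as ℤS
open import Data.Integer.Tactic.RingSolver using (solve; solve-∀)
open import Data.Fin using (Fin; zero; suc)
open import Data.Fin.Patterns using (0F; 1F; 2F)
open import Data.List using ([]; _∷_)
open import Data.Empty using (⊥-elim)
open import Data.Product using (_×_; _,_; ∃-syntax; proj₁; proj₂)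
open import Data.Sum using (inj₁; inj₂)
open import Function.Base using (_∘_)
open import Function.Definitions using (Injective)
open import Function.Bundles using (_⇔_; mk⇔)
open import Level using (0ℓ)
open import Relation.Binary.Bundles using (Setoid)
open import Relation.Binary.PropositionalEquality
  using (_≡_; _≢_; refl; sym; trans; cong; cong₂; subst)
import Relation.Binary.Reasoning.Setoid as SetoidReasoning
open import Relation.Nullary using (¬_; Dec; yes; no)
open import Relation.Nullary.Decidable using (decidable-stable; map′)

vec₃ : ∀ {A : Set} → A → A → A → Fin 3 → A
vec₃ x y z 0F = x
vec₃ x y z 1F = y
vec₃ x y z 2F = z

sum₃ : (Fin 3 → ℤ) → ℤ
sum₃ v = v 0F + v 1F + v 2F

-- Arithmetic in the field with `p` elements.

module PrimeField (p : ℕ) (p-prime : Prime p) where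

  infix 4 _≋_ _≋?_

  -- The congruence of Defs unfolds to a divisibility from which Agda cannot
  -- recover a and b; the record makes them inferable.
  record _≋_ (a b : ℤ) : Set where
    constructor mod
    field p∣a-b : + p ℤS.∣ a - b

  ≡mod⇒≋ : ∀ {a b} → a ≡ b [mod p ] → a ≋ b
  ≡mod⇒≋ p∣a-b = mod (ℤS.∣ᵤ⇒∣ p∣a-b)

  ≋⇒≡mod : ∀ {a b} → a ≋ b → a ≡ b [mod p ]
  ≋⇒≡mod (mod p∣a-b) = ℤS.∣⇒∣ᵤ p∣a-b

  -- Decidability keeps the argument constructive: it provides the case split in `det-M≄0` and
  -- removes the double negation in `ξ≉𝟘⇒independent`.
  _≋?_ : ∀ a b → Dec (a ≋ b)
  a ≋? b = map′ mod _≋_.p∣a-b (+ p ℤS.∣? (a - b))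

  ≋-reflexive : ∀ {a b} → a ≡ b → a ≋ b
  ≋-reflexive {a} refl = mod (ℤS.divides 0ℤ (ℤ.+-inverseʳ a))

  ≋-refl : ∀ {a} → a ≋ a
  ≋-refl = ≋-reflexive refl

  ≋-sym : ∀ {a b} → a ≋ b → b ≋ a
  ≋-sym {a} {b} (mod d) = mod (subst (+ p ℤS.∣_) (lemma a b) (ℤS.∣m⇒∣-m d))
    where
    lemma : ∀ a b → - (a - b) ≡ b - a
    lemma = solve-∀

  ≋-trans : ∀ {a b c} → a ≋ b → b ≋ c → a ≋ c
  ≋-trans {a} {b} {c} (mod d) (mod d′) =
    mod (subst (+ p ℤS.∣_) (lemma a b c) (ℤS.∣m∣n⇒∣m+n d d′))
    where
    lemma : ∀ a b c → (a - b) + (b - c) ≡ a - c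
    lemma = solve-∀

  +-cong : ∀ {a b a′ b′} → a ≋ b → a′ ≋ b′ → a + a′ ≋ b + b′
  +-cong {a} {b} {a′} {b′} (mod d) (mod d′) =
    mod (subst (+ p ℤS.∣_) (lemma a b a′ b′) (ℤS.∣m∣n⇒∣m+n d d′))
    where
    lemma : ∀ a b a′ b′ → (a - b) + (a′ - b′) ≡ (a + a′) - (b + b′)
    lemma = solve-∀

  *-cong : ∀ {a b a′ b′} → a ≋ b → a′ ≋ b′ → a * a′ ≋ b * b′
  *-cong {a} {b} {a′} {b′} (mod d) (mod d′) =
    mod (subst (+ p ℤS.∣_) (lemma a b a′ b′)
      (ℤS.∣m∣n⇒∣m+n (ℤS.∣m⇒∣m*n a′ d) (ℤS.∣n⇒∣m*n b d′)))
    where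
    lemma : ∀ a b a′ b′ → (a - b) * a′ + b * (a′ - b′) ≡ a * a′ - b * b′
    lemma = solve-∀

  neg-cong : ∀ {a b} → a ≋ b → - a ≋ - b
  neg-cong {a} {b} (mod d) = mod (subst (+ p ℤS.∣_) (lemma a b) (ℤS.∣m⇒∣-m d))
    where
    lemma : ∀ a b → - (a - b) ≡ - a - - b
    lemma = solve-∀

  ≋-setoid : Setoid 0ℓ 0ℓ
  ≋-setoid = record
    { Carrier       = ℤ
    ; _≈_           = _≋_
    ; isEquivalence = record { refl = ≋-refl ; sym = ≋-sym ; trans = ≋-trans }
    }

  *-congˡ : ∀ a {b b′} → b ≋ b′ → a * b ≋ a * b′
  *-congˡ a = *-cong (≋-refl {a})

  *-congʳ : ∀ a {b b′} → b ≋ b′ → b * a ≋ b′ * a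
  *-congʳ a b≋b′ = *-cong b≋b′ (≋-refl {a})

  +≋0⇒≋- : ∀ {a b} → a + b ≋ 0ℤ → a ≋ - b
  +≋0⇒≋- {a} {b} (mod d) = mod (subst (+ p ℤS.∣_) (lemma a b) d)
    where
    lemma : ∀ a b → (a + b) - 0ℤ ≡ a - - b
    lemma = solve-∀

  ≋⇒-≋0 : ∀ {a b} → a ≋ b → a - b ≋ 0ℤ
  ≋⇒-≋0 {a} {b} (mod d) = mod (subst (+ p ℤS.∣_) (sym (ℤ.+-identityʳ (a - b))) d)

  *-≋0ˡ : ∀ a {b} → b ≋ 0ℤ → a * b ≋ 0ℤ
  *-≋0ˡ a b≋0 = ≋-trans (*-congˡ a b≋0) (≋-reflexive (ℤ.*-zeroʳ a))

  *-≋0ʳ : ∀ a {b} → b ≋ 0ℤ → b * a ≋ 0ℤ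
  *-≋0ʳ a b≋0 = *-congʳ a b≋0

  +-≋0 : ∀ {a b} → a ≋ 0ℤ → b ≋ 0ℤ → a + b ≋ 0ℤ
  +-≋0 = +-cong

  sum₃-*≋0 : ∀ (v w : Fin 3 → ℤ) → (∀ i → v i ≋ 0ℤ) → sum₃ (λ i → v i * w i) ≋ 0ℤ
  sum₃-*≋0 v w v≋0 = +-≋0 (+-≋0 (term 0F) (term 1F)) (term 2F)
    where
    term : ∀ i → v i * w i ≋ 0ℤ
    term i = *-≋0ʳ (w i) (v≋0 i)

  ≋0⇒∣ : ∀ {a} → a ≋ 0ℤ → p ∣ ℤ.∣ a ∣
  ≋0⇒∣ {a} (mod d) = ℤS.∣⇒∣ᵤ (subst (+ p ℤS.∣_) (ℤ.+-identityʳ a) d)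

  ∣⇒≋0 : ∀ {a} → p ∣ ℤ.∣ a ∣ → a ≋ 0ℤ
  ∣⇒≋0 {a} d = mod (subst (+ p ℤS.∣_) (sym (ℤ.+-identityʳ a)) (ℤS.∣ᵤ⇒∣ d))

  p≢1 : p ≢ 1
  p≢1 refl with () ← prime⇒nonTrivial p-prime

  private
    inverse-ℕ : ∀ n → ¬ p ∣ n → ∃[ b ] b * + n ≋ 1ℤ
    inverse-ℕ n p∤n = bézout (coprime-Bézout coprime)
      where
      coprime : Coprime p n
      coprime (d∣p , d∣n) with prime⇒irreducible p-prime d∣p
      ... | inj₁ d≡1  = d≡1
      ... | inj₂ refl = ⊥-elim (p∤n d∣n)

      lift : ∀ {x y u v} → 1 ℕ.+ x ℕ.* u ≡ y ℕ.* v → 1ℤ + + x * + u ≡ + y * + v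
      lift {x} {y} {u} {v} eq =
        trans (cong (λ z → 1ℤ + z) (sym (ℤ.pos-* x u))) (trans (cong (λ z → + z) eq) (ℤ.pos-* y v))

      shift⁻ : ∀ {x y u v} → 1ℤ + x * u ≡ y * v → - x * u - 1ℤ ≡ - y * v
      shift⁻ {x} {y} {u} {v} eq =
        trans (lemma x u) (trans (cong -_ eq) (ℤ.neg-distribˡ-* y v))
        where
        lemma : ∀ x u → - x * u - 1ℤ ≡ - (1ℤ + x * u)
        lemma = solve-∀

      shift⁺ : ∀ {x y u v} → 1ℤ + x * u ≡ y * v → y * v - 1ℤ ≡ x * u
      shift⁺ {x} {y} {u} {v} eq = trans (cong (_- 1ℤ) (sym eq)) (lemma x u)
        where
        lemma : ∀ x u → 1ℤ + x * u - 1ℤ ≡ x * u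
        lemma = solve-∀

      bézout : Bézout.Identity 1 p n → ∃[ b ] b * + n ≋ 1ℤ
      -- The two Bézout identities differ in sign. Here `1 + y n = x p`, so `- y` inverts `n`; in
      -- the other case `1 + x p = y n`, and `y` does.
      bézout (Bézout.+- x y eq) =
        - + y , mod (ℤS.divides (- + x) (shift⁻ {+ y} {+ x} (lift {y} {x} eq)))
      bézout (Bézout.-+ x y eq) =
        + y , mod (ℤS.divides (+ x) (shift⁺ {+ x} {+ y} (lift {x} {y} eq)))

  inverse : ∀ a → ¬ a ≋ 0ℤ → ∃[ b ] b * a ≋ 1ℤ
  inverse (+ n) a≄0 = inverse-ℕ n (a≄0 ∘ ∣⇒≋0)
  inverse -[1+ n ] a≄0 with b , b*n≋1 ← inverse-ℕ (suc n) (a≄0 ∘ ∣⇒≋0) =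
    - b , ≋-trans (≋-reflexive (lemma b (+ suc n))) b*n≋1
    where
    lemma : ∀ b a → - b * - a ≡ b * a
    lemma = solve-∀

  *≋0⇒≋0 : ∀ {a b} → ¬ a ≋ 0ℤ → a * b ≋ 0ℤ → b ≋ 0ℤ
  *≋0⇒≋0 {a} {b} a≄0 ab≋0 with a⁻¹ , a⁻¹a≋1 ← inverse a a≄0 = begin
    b              ≡⟨ ℤ.*-identityˡ b ⟨
    1ℤ * b         ≈⟨ *-congʳ b a⁻¹a≋1 ⟨
    a⁻¹ * a * b    ≡⟨ ℤ.*-assoc a⁻¹ a b ⟩
    a⁻¹ * (a * b)  ≈⟨ *-≋0ˡ a⁻¹ ab≋0 ⟩
    0ℤ             ∎
    where open SetoidReasoning ≋-setoid

  quotient : ∀ a b → ¬ a ≋ 0ℤ → ∃[ x ] a * x ≋ b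
  quotient a b a≄0 with a⁻¹ , a⁻¹a≋1 ← inverse a a≄0 = a⁻¹ * b , (begin
    a * (a⁻¹ * b)  ≡⟨ lemma a a⁻¹ b ⟩
    a⁻¹ * a * b    ≈⟨ *-congʳ b a⁻¹a≋1 ⟩
    1ℤ * b         ≡⟨ ℤ.*-identityˡ b ⟩
    b              ∎)
    where
    open SetoidReasoning ≋-setoid
    lemma : ∀ a i b → a * (i * b) ≡ i * a * b
    lemma = solve-∀

  -- Multiplying `a′ * x + b′` by the unit `a` gives `a′ * b + a * b′`, which vanishes. In this way
  -- each equation of the criterion becomes the compatibility of two linear equations for one
  -- unknown `x`.
  cross-quotient : ∀ a a′ b b′ x → ¬ a ≋ 0ℤ → a * x ≋ b → a * b′ ≋ - (a′ * b) → a′ * x ≋ - b′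
  cross-quotient a a′ b b′ x a≄0 ax≋b ab′≋-a′b = +≋0⇒≋- (*≋0⇒≋0 a≄0 (begin
    a * (a′ * x + b′)        ≡⟨ lemma a a′ x b′ ⟩
    a′ * (a * x) + a * b′    ≈⟨ +-cong (*-congˡ a′ ax≋b) ab′≋-a′b ⟩
    a′ * b + - (a′ * b)      ≡⟨ ℤ.+-inverseʳ (a′ * b) ⟩
    0ℤ                       ∎))
    where
    open SetoidReasoning ≋-setoid
    lemma : ∀ a a′ x b′ → a * (a′ * x + b′) ≡ a′ * (a * x) + a * b′
    lemma = solve-∀

  *-≄0 : ∀ {a b} → ¬ a ≋ 0ℤ → ¬ b ≋ 0ℤ → ¬ a * b ≋ 0ℤ
  *-≄0 a≄0 b≄0 ab≋0 = b≄0 (*≋0⇒≋0 a≄0 ab≋0)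

-- Cross product constants and the criterion.

δ : Fin 3 → Fin 3 → ℤ
δ 0F = vec₃ 1ℤ 0ℤ 0ℤ
δ 1F = vec₃ 0ℤ 1ℤ 0ℤ
δ 2F = vec₃ 0ℤ 0ℤ 1ℤ

-- ε i j is the cross product of the i-th and j-th standard basis vectors.
ε : Fin 3 → Fin 3 → Fin 3 → ℤ
ε 0F 1F = δ 2F
ε 1F 2F = δ 0F
ε 2F 0F = δ 1F
ε 1F 0F = λ k → - 1ℤ * δ 2F k
ε 2F 1F = λ k → - 1ℤ * δ 0F k
ε 0F 2F = λ k → - 1ℤ * δ 1F k
ε 0F 0F = λ _ → 0ℤ
ε 1F 1F = λ _ → 0ℤ
ε 2F 2F = λ _ → 0ℤ

-- The equalities of quotients are cleared of denominators, which changes nothing when every `c i`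
-- is a unit modulo `p`.
RepresentationCriterion : ℕ → (Fin 3 → ℤ) → (Fin 3 → Fin 3 → ℤ) → Set
RepresentationCriterion p c ℓ =
  (∀ i j → i ≢ j → ¬ ℓ i j ≡ + 0 [mod p ]) ×
  (ℓ 0F 2F * c 1F ≡ - (ℓ 1F 2F * c 0F) [mod p ]) ×
  (ℓ 1F 0F * c 2F ≡ - (ℓ 2F 0F * c 1F) [mod p ]) ×
  (ℓ 0F 1F * c 2F ≡ - (ℓ 2F 1F * c 0F) [mod p ])

-- Linear algebra in the linking algebra.

module LinkingModule
  (p : ℕ) (p-prime : Prime p) (c : Fin 3 → ℤ) (ℓ : Fin 3 → Fin 3 → ℤ) where

  open PrimeField p p-prime
  open LinkingAlgebra p c ℓ
    renaming (refl to ≈-refl; sym to ≈-sym; trans to ≈-trans)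

  ≈-setoid : Setoid 0ℓ 0ℓ
  ≈-setoid = record
    { Carrier       = LTerm
    ; _≈_           = _≈_
    ; isEquivalence = record { refl = ≈-refl ; sym = ≈-sym ; trans = ≈-trans }
    }

  ⊕-commutativeSemigroup : CommutativeSemigroup 0ℓ 0ℓ
  ⊕-commutativeSemigroup = record
    { isCommutativeSemigroup = record
      { isSemigroup = record
        { isMagma = record
          { isEquivalence = Setoid.isEquivalence ≈-setoid
          ; ∙-cong        = ⊕-cong
          }
        ; assoc = ⊕-assoc
        }
      ; comm = ⊕-comm
      }
    }

  open CommutativeSemigroupProperties ⊕-commutativeSemigroup using (interchange)
  open SetoidReasoning ≈-setoid

  ⊙-congˡ : ∀ a {x y} → x ≈ y → a ⊙ x ≈ a ⊙ y
  ⊙-congˡ a = ⊙-cong (≋⇒≡mod (≋-refl {a}))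

  ⊙-congʳ : ∀ {a b} x → a ≋ b → a ⊙ x ≈ b ⊙ x
  ⊙-congʳ x a≋b = ⊙-cong (≋⇒≡mod a≋b) ≈-refl

  ⊙-congʳ-≡ : ∀ {a b} x → a ≡ b → a ⊙ x ≈ b ⊙ x
  ⊙-congʳ-≡ x a≡b = ⊙-congʳ x (≋-reflexive a≡b)

  ⊕-idˡ : ∀ x → 𝟘 ⊕ x ≈ x
  ⊕-idˡ x = ≈-trans (⊕-comm 𝟘 x) (⊕-idʳ x)

  ⊕≈𝟘⇒≈- : ∀ {x y} → x ⊕ y ≈ 𝟘 → x ≈ (- 1ℤ) ⊙ y
  ⊕≈𝟘⇒≈- {x} {y} x⊕y≈𝟘 = begin
    x                       ≈⟨ ⊕-idʳ x ⟨
    x ⊕ 𝟘                   ≈⟨ ⊕-cong ≈-refl (⊕-invʳ y) ⟨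
    x ⊕ (y ⊕ (- 1ℤ) ⊙ y)    ≈⟨ ⊕-assoc x y _ ⟨
    (x ⊕ y) ⊕ (- 1ℤ) ⊙ y    ≈⟨ ⊕-cong x⊕y≈𝟘 ≈-refl ⟩
    𝟘 ⊕ (- 1ℤ) ⊙ y          ≈⟨ ⊕-idˡ _ ⟩
    (- 1ℤ) ⊙ y              ∎

  ⊙-zeroˡ : ∀ x → 0ℤ ⊙ x ≈ 𝟘
  ⊙-zeroˡ x = begin
    -- `0ℤ` computes to `1ℤ + - 1ℤ`, so distributivity applies directly.
    0ℤ ⊙ x                  ≈⟨ ⊙-distribʳ 1ℤ (- 1ℤ) x ⟩
    1ℤ ⊙ x ⊕ (- 1ℤ) ⊙ x     ≈⟨ ⊕-cong (⊙-one x) ≈-refl ⟩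
    x ⊕ (- 1ℤ) ⊙ x          ≈⟨ ⊕-invʳ x ⟩
    𝟘                       ∎

  ⊙-zeroʳ : ∀ a → a ⊙ 𝟘 ≈ 𝟘
  ⊙-zeroʳ a = begin
    a ⊙ 𝟘          ≈⟨ ⊙-congˡ a (⊙-zeroˡ 𝟘) ⟨
    a ⊙ 0ℤ ⊙ 𝟘     ≈⟨ ⊙-assoc a 0ℤ 𝟘 ⟨
    (a * 0ℤ) ⊙ 𝟘   ≈⟨ ⊙-congʳ-≡ 𝟘 (ℤ.*-zeroʳ a) ⟩
    0ℤ ⊙ 𝟘         ≈⟨ ⊙-zeroˡ 𝟘 ⟩
    𝟘              ∎

  ⊙-swap : ∀ a b x → a ⊙ b ⊙ x ≈ b ⊙ a ⊙ x
  ⊙-swap a b x = begin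
    a ⊙ b ⊙ x    ≈⟨ ⊙-assoc a b x ⟨
    (a * b) ⊙ x  ≈⟨ ⊙-congʳ-≡ x (ℤ.*-comm a b) ⟩
    (b * a) ⊙ x  ≈⟨ ⊙-assoc b a x ⟩
    b ⊙ a ⊙ x    ∎

  ⊙≈𝟘⇒≈𝟘 : ∀ {a x} → ¬ a ≋ 0ℤ → a ⊙ x ≈ 𝟘 → x ≈ 𝟘
  ⊙≈𝟘⇒≈𝟘 {a} {x} a≄0 ax≈𝟘 with a⁻¹ , a⁻¹a≋1 ← inverse a a≄0 = begin
    x              ≈⟨ ⊙-one x ⟨
    1ℤ ⊙ x         ≈⟨ ⊙-congʳ x a⁻¹a≋1 ⟨
    (a⁻¹ * a) ⊙ x  ≈⟨ ⊙-assoc a⁻¹ a x ⟩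
    a⁻¹ ⊙ a ⊙ x    ≈⟨ ⊙-congˡ a⁻¹ ax≈𝟘 ⟩
    a⁻¹ ⊙ 𝟘        ≈⟨ ⊙-zeroʳ a⁻¹ ⟩
    𝟘              ∎

  -- Writing `𝟘` as `0ℤ ⊙ 𝟘` lets homogeneity of the bracket pull out the scalar zero.
  br-zeroˡ : ∀ x → ⟦ 𝟘 , x ⟧ ≈ 𝟘
  br-zeroˡ x = begin
    ⟦ 𝟘 , x ⟧       ≈⟨ br-cong (⊙-zeroˡ 𝟘) ≈-refl ⟨
    ⟦ 0ℤ ⊙ 𝟘 , x ⟧  ≈⟨ br-⊙ˡ 0ℤ 𝟘 x ⟩
    0ℤ ⊙ ⟦ 𝟘 , x ⟧  ≈⟨ ⊙-zeroˡ _ ⟩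
    𝟘               ∎

  br-zeroʳ : ∀ x → ⟦ x , 𝟘 ⟧ ≈ 𝟘
  br-zeroʳ x = begin
    ⟦ x , 𝟘 ⟧       ≈⟨ br-cong ≈-refl (⊙-zeroˡ 𝟘) ⟨
    ⟦ x , 0ℤ ⊙ 𝟘 ⟧  ≈⟨ br-⊙ʳ 0ℤ x 𝟘 ⟩
    0ℤ ⊙ ⟦ x , 𝟘 ⟧  ≈⟨ ⊙-zeroˡ _ ⟩
    𝟘               ∎

  -- Polarisation: expand `⟦ x ⊕ y , x ⊕ y ⟧ ≈ 𝟘` and discard the two diagonal brackets.
  br-anti : ∀ x y → ⟦ x , y ⟧ ≈ (- 1ℤ) ⊙ ⟦ y , x ⟧
  br-anti x y = ⊕≈𝟘⇒≈- (begin
    ⟦ x , y ⟧ ⊕ ⟦ y , x ⟧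
      ≈⟨ ⊕-cong (⊕-idˡ _) (⊕-idʳ _) ⟨
    (𝟘 ⊕ ⟦ x , y ⟧) ⊕ (⟦ y , x ⟧ ⊕ 𝟘)
      ≈⟨ ⊕-cong (⊕-cong (br-alt x) ≈-refl) (⊕-cong ≈-refl (br-alt y)) ⟨
    (⟦ x , x ⟧ ⊕ ⟦ x , y ⟧) ⊕ (⟦ y , x ⟧ ⊕ ⟦ y , y ⟧)
      ≈⟨ ⊕-cong (br-⊕ʳ x x y) (br-⊕ʳ y x y) ⟨
    ⟦ x , x ⊕ y ⟧ ⊕ ⟦ y , x ⊕ y ⟧
      ≈⟨ br-⊕ˡ x y (x ⊕ y) ⟨
    ⟦ x ⊕ y , x ⊕ y ⟧
      ≈⟨ br-alt (x ⊕ y) ⟩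
    𝟘 ∎)

  Σ₃-cong : ∀ {f g} → (∀ i → f i ≈ g i) → Σ₃ f ≈ Σ₃ g
  Σ₃-cong f≈g = ⊕-cong (⊕-cong (f≈g 0F) (f≈g 1F)) (f≈g 2F)

  Σ₃-⊕ : ∀ f g → Σ₃ (λ i → f i ⊕ g i) ≈ Σ₃ f ⊕ Σ₃ g
  Σ₃-⊕ f g = ≈-trans (⊕-cong (interchange _ _ _ _) ≈-refl) (interchange _ _ _ _)

  Σ₃-𝟘 : ∀ {f} → (∀ i → f i ≈ 𝟘) → Σ₃ f ≈ 𝟘
  Σ₃-𝟘 f≈𝟘 = ≈-trans (Σ₃-cong f≈𝟘) (≈-trans (⊕-idʳ _) (⊕-idʳ _))

  ⊙-Σ₃ : ∀ a f → a ⊙ Σ₃ f ≈ Σ₃ (λ i → a ⊙ f i)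
  ⊙-Σ₃ a f = ≈-trans (⊙-distribˡ a _ _) (⊕-cong (⊙-distribˡ a _ _) ≈-refl)

  -- With coefficients collected in a vector, equations between Lie terms reduce to equations
  -- between integer vectors, which the ring solver can settle.
  comb : (Fin 3 → LTerm) → (Fin 3 → ℤ) → LTerm
  comb e v = Σ₃ (λ i → v i ⊙ e i)

  comb-congˡ : ∀ {e e′} v → (∀ i → e i ≈ e′ i) → comb e v ≈ comb e′ v
  comb-congˡ v e≈e′ = Σ₃-cong (λ i → ⊙-congˡ (v i) (e≈e′ i))

  comb-congʳ : ∀ e {v w} → (∀ i → v i ≋ w i) → comb e v ≈ comb e w
  comb-congʳ e v≋w = Σ₃-cong (λ i → ⊙-congʳ (e i) (v≋w i))

  comb-congʳ-≡ : ∀ e {v w} → (∀ i → v i ≡ w i) → comb e v ≈ comb e w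
  comb-congʳ-≡ e v≡w = comb-congʳ e (≋-reflexive ∘ v≡w)

  comb-0 : ∀ e → comb e (λ _ → 0ℤ) ≈ 𝟘
  comb-0 e = Σ₃-𝟘 (⊙-zeroˡ ∘ e)

  comb-≋0 : ∀ e {v} → (∀ i → v i ≋ 0ℤ) → comb e v ≈ 𝟘
  comb-≋0 e v≋0 = ≈-trans (comb-congʳ e v≋0) (comb-0 e)

  comb-+ : ∀ e v w → comb e (λ i → v i + w i) ≈ comb e v ⊕ comb e w
  comb-+ e v w = ≈-trans (Σ₃-cong (λ i → ⊙-distribʳ (v i) (w i) (e i)))
    (Σ₃-⊕ (λ i → v i ⊙ e i) (λ i → w i ⊙ e i))

  comb-* : ∀ e a v → comb e (λ i → a * v i) ≈ a ⊙ comb e v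
  comb-* e a v = ≈-trans (Σ₃-cong (λ i → ⊙-assoc a (v i) (e i)))
    (≈-sym (⊙-Σ₃ a (λ i → v i ⊙ e i)))

  Σ₃-comb : ∀ e (A : Fin 3 → Fin 3 → ℤ) →
    Σ₃ (λ j → comb e (A j)) ≈ comb e (λ k → sum₃ (λ j → A j k))
  Σ₃-comb e A = ≈-sym (≈-trans
    (comb-+ e (λ k → A 0F k + A 1F k) (A 2F))
    (⊕-cong (comb-+ e (A 0F) (A 1F)) ≈-refl))

  -- Substituting combinations into a combination multiplies the row `v` by the matrix `A`. The
  -- matrix computations with `M`, `N` and `ε` all pass through this.
  comb-comb : ∀ e (A : Fin 3 → Fin 3 → ℤ) v →
    comb (λ j → comb e (A j)) v ≈ comb e (λ k → sum₃ (λ j → v j * A j k))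
  comb-comb e A v =
    ≈-trans (Σ₃-cong (λ j → ≈-sym (comb-* e (v j) (A j))))
      (Σ₃-comb e (λ j k → v j * A j k))

  comb-const : ∀ x v → comb (λ _ → x) v ≈ sum₃ v ⊙ x
  comb-const x v =
    ≈-sym (≈-trans (⊙-distribʳ _ (v 2F) x) (⊕-cong (⊙-distribʳ (v 0F) (v 1F) x) ≈-refl))

  comb-⊙ : ∀ e a v → comb (λ j → a ⊙ e j) v ≈ a ⊙ comb e v
  comb-⊙ e a v =
    ≈-trans (Σ₃-cong (λ j → ⊙-swap (v j) a (e j)))
    (≈-sym (⊙-Σ₃ a (λ j → v j ⊙ e j)))

  comb-scaled : ∀ e (s : Fin 3 → ℤ) v → comb (λ i → s i ⊙ e i) v ≈ comb e (λ i → v i * s i)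
  comb-scaled e s v = Σ₃-cong (λ i → ≈-sym (⊙-assoc (v i) (s i) (e i)))

  comb-δ : ∀ e i → comb e (δ i) ≈ e i
  comb-δ e 0F = ≈-trans (⊕-cong (≈-trans (⊕-cong (⊙-one _) (⊙-zeroˡ _)) (⊕-idʳ _)) (⊙-zeroˡ _)) (⊕-idʳ _)
  comb-δ e 1F = ≈-trans (⊕-cong (≈-trans (⊕-cong (⊙-zeroˡ _) (⊙-one _)) (⊕-idˡ _)) (⊙-zeroˡ _)) (⊕-idʳ _)
  comb-δ e 2F = ≈-trans (⊕-cong (≈-trans (⊕-cong (⊙-zeroˡ _) (⊙-zeroˡ _)) (⊕-idʳ _)) (⊙-one _)) (⊕-idˡ _)

  comb-*δ : ∀ e a i → comb e (λ j → a * δ i j) ≈ a ⊙ e i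
  comb-*δ e a i = ≈-trans (comb-* e a (δ i)) (⊙-congˡ a (comb-δ e i))

  br-combʳ : ∀ x e v → ⟦ x , comb e v ⟧ ≈ comb (λ i → ⟦ x , e i ⟧) v
  br-combʳ x e v = ≈-trans
    (≈-trans (br-⊕ʳ x _ _) (⊕-cong (br-⊕ʳ x _ _) ≈-refl))
    (Σ₃-cong (λ i → br-⊙ʳ (v i) x (e i)))

  -- The defining relations in terms of brackets of generators.

  P : Fin 3 → LTerm
  P = vec₃ ⟦ ξ 1F , ξ 2F ⟧ ⟦ ξ 2F , ξ 0F ⟧ ⟦ ξ 0F , ξ 1F ⟧

  -- The cyclic orientation of `P` makes the bracket of generators the cross product of basis
  -- vectors. With the same orientation the Jacobi identity of the generators is literally the sum
  -- of the `⟦ ξ i , P i ⟧`.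
  br-ξ : ∀ i j → ⟦ ξ i , ξ j ⟧ ≈ comb P (ε i j)
  br-ξ 0F 0F = ≈-trans (br-alt _) (≈-sym (comb-0 P))
  br-ξ 1F 1F = ≈-trans (br-alt _) (≈-sym (comb-0 P))
  br-ξ 2F 2F = ≈-trans (br-alt _) (≈-sym (comb-0 P))
  br-ξ 0F 1F = ≈-sym (comb-δ P 2F)
  br-ξ 1F 2F = ≈-sym (comb-δ P 0F)
  br-ξ 2F 0F = ≈-sym (comb-δ P 1F)
  br-ξ 1F 0F = ≈-trans (br-anti _ _) (≈-sym (comb-*δ P (- 1ℤ) 2F))
  br-ξ 2F 1F = ≈-trans (br-anti _ _) (≈-sym (comb-*δ P (- 1ℤ) 0F))
  br-ξ 0F 2F = ≈-trans (br-anti _ _) (≈-sym (comb-*δ P (- 1ℤ) 1F))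

  br-ξ-comb : ∀ i v → ⟦ ξ i , comb ξ v ⟧ ≈ comb P (λ k → sum₃ (λ j → v j * ε i j k))
  br-ξ-comb i v = begin
    ⟦ ξ i , comb ξ v ⟧                        ≈⟨ br-combʳ (ξ i) ξ v ⟩
    comb (λ j → ⟦ ξ i , ξ j ⟧) v              ≈⟨ comb-congˡ v (br-ξ i) ⟩
    comb (λ j → comb P (ε i j)) v             ≈⟨ comb-comb P (ε i) v ⟩
    comb P (λ k → sum₃ (λ j → v j * ε i j k)) ∎

  -- Row `i` is minus the sum of the vectors `ℓ i j * ε i j` over `j`: the brackets of the `i`-th
  -- relation are moved to the other side and written in `P`.
  M : Fin 3 → Fin 3 → ℤ
  M 0F = vec₃ 0ℤ (ℓ 0F 2F) (- ℓ 0F 1F)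
  M 1F = vec₃ (- ℓ 1F 2F) 0ℤ (ℓ 1F 0F)
  M 2F = vec₃ (ℓ 2F 1F) (- ℓ 2F 0F) 0ℤ

  private
    -- `linkRel` has `𝟘` in the diagonal place, while `comb` puts `ℓ i i ⊙ ⟦ ξ i , ξ i ⟧` there; the
    -- two agree because the bracket is alternating.
    linkRel-comb : ∀ i → c i ⊙ ξ i ⊕ comb (λ j → ⟦ ξ i , ξ j ⟧) (ℓ i) ≈ 𝟘
    linkRel-comb i = ≈-trans (add-diagonal i) (rel i)
      where
      diagonal : ∀ i → ℓ i i ⊙ ⟦ ξ i , ξ i ⟧ ≈ 𝟘
      diagonal i = ≈-trans (⊙-congˡ (ℓ i i) (br-alt (ξ i))) (⊙-zeroʳ (ℓ i i))

      add-diagonal : ∀ i → c i ⊙ ξ i ⊕ comb (λ j → ⟦ ξ i , ξ j ⟧) (ℓ i) ≈ linkRel c ℓ i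
      add-diagonal 0F = ⊕-cong ≈-refl (⊕-cong (⊕-cong (diagonal 0F) ≈-refl) ≈-refl)
      add-diagonal 1F = ⊕-cong ≈-refl (⊕-cong (⊕-cong ≈-refl (diagonal 1F)) ≈-refl)
      add-diagonal 2F = ⊕-cong ≈-refl (⊕-cong ≈-refl (diagonal 2F))

    M-entries : ∀ i k → - 1ℤ * sum₃ (λ j → ℓ i j * ε i j k) ≡ M i k
    M-entries = entry
      where
      lemma-0 : ∀ x y z → - 1ℤ * (x * 0ℤ + y * 0ℤ + z * 0ℤ) ≡ 0ℤ
      lemma-0 = solve-∀
      lemma-x : ∀ x y z → - 1ℤ * (x * - 1ℤ + y * 0ℤ + z * 0ℤ) ≡ x
      lemma-x = solve-∀
      lemma-y : ∀ x y z → - 1ℤ * (x * 0ℤ + y * - 1ℤ + z * 0ℤ) ≡ y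
      lemma-y = solve-∀
      lemma-z : ∀ x y z → - 1ℤ * (x * 0ℤ + y * 0ℤ + z * - 1ℤ) ≡ z
      lemma-z = solve-∀
      lemma--x : ∀ x y z → - 1ℤ * (x * 1ℤ + y * 0ℤ + z * 0ℤ) ≡ - x
      lemma--x = solve-∀
      lemma--y : ∀ x y z → - 1ℤ * (x * 0ℤ + y * 1ℤ + z * 0ℤ) ≡ - y
      lemma--y = solve-∀
      lemma--z : ∀ x y z → - 1ℤ * (x * 0ℤ + y * 0ℤ + z * 1ℤ) ≡ - z
      lemma--z = solve-∀

      entry : ∀ i k → - 1ℤ * sum₃ (λ j → ℓ i j * ε i j k) ≡ M i k
      entry 0F 0F = lemma-0 (ℓ 0F 0F) (ℓ 0F 1F) (ℓ 0F 2F)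
      entry 0F 1F = lemma-z (ℓ 0F 0F) (ℓ 0F 1F) (ℓ 0F 2F)
      entry 0F 2F = lemma--y (ℓ 0F 0F) (ℓ 0F 1F) (ℓ 0F 2F)
      entry 1F 0F = lemma--z (ℓ 1F 0F) (ℓ 1F 1F) (ℓ 1F 2F)
      entry 1F 1F = lemma-0 (ℓ 1F 0F) (ℓ 1F 1F) (ℓ 1F 2F)
      entry 1F 2F = lemma-x (ℓ 1F 0F) (ℓ 1F 1F) (ℓ 1F 2F)
      entry 2F 0F = lemma-y (ℓ 2F 0F) (ℓ 2F 1F) (ℓ 2F 2F)
      entry 2F 1F = lemma--x (ℓ 2F 0F) (ℓ 2F 1F) (ℓ 2F 2F)
      entry 2F 2F = lemma-0 (ℓ 2F 0F) (ℓ 2F 1F) (ℓ 2F 2F)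

  ξ-relation : ∀ i → c i ⊙ ξ i ≈ comb P (M i)
  ξ-relation i = begin
    c i ⊙ ξ i
      ≈⟨ ⊕≈𝟘⇒≈- (linkRel-comb i) ⟩
    (- 1ℤ) ⊙ comb (λ j → ⟦ ξ i , ξ j ⟧) (ℓ i)
      ≈⟨ ⊙-congˡ (- 1ℤ) (comb-congˡ (ℓ i) (br-ξ i)) ⟩
    (- 1ℤ) ⊙ comb (λ j → comb P (ε i j)) (ℓ i)
      ≈⟨ ⊙-congˡ (- 1ℤ) (comb-comb P (ε i) (ℓ i)) ⟩
    (- 1ℤ) ⊙ comb P (λ k → sum₃ (λ j → ℓ i j * ε i j k))
      ≈⟨ comb-* P (- 1ℤ) (λ k → sum₃ (λ j → ℓ i j * ε i j k)) ⟨
    comb P (λ k → - 1ℤ * sum₃ (λ j → ℓ i j * ε i j k))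
      ≈⟨ comb-congʳ-≡ P (M-entries i) ⟩
    comb P (M i) ∎

  -- A linear dependence among the generators.

  module _ (c≄0 : ∀ i → ¬ c i ≋ 0ℤ) where

    P≈𝟘⇒ξ≈𝟘 : (∀ i → P i ≈ 𝟘) → ∀ i → ξ i ≈ 𝟘
    P≈𝟘⇒ξ≈𝟘 P≈𝟘 i = ⊙≈𝟘⇒≈𝟘 (c≄0 i) (≈-trans (ξ-relation i)
      (Σ₃-𝟘 (λ k → ≈-trans (⊙-congˡ (M i k) (P≈𝟘 k)) (⊙-zeroʳ (M i k)))))

    -- Bracketing a relation Σ tᵢ ξᵢ = 0 with the generators shows that (P₀ , P₁ , P₂)
    -- is proportional to t, so that all ξᵢ are multiples of a single Pₖ.
    module Dependent (t : Fin 3 → ℤ) (t≈𝟘 : comb ξ t ≈ 𝟘) where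

      br-t : ∀ i → comb P (λ k → sum₃ (λ j → t j * ε i j k)) ≈ 𝟘
      br-t i = ≈-trans (≈-sym (br-ξ-comb i t)) (≈-trans (br-cong ≈-refl t≈𝟘) (br-zeroʳ (ξ i)))

      difference : ∀ i j → comb P (λ k → t i * δ j k + - t j * δ i k) ≈ 𝟘 →
        t i ⊙ P j ≈ t j ⊙ P i
      difference i j d≈𝟘 = begin
        t i ⊙ P j                     ≈⟨ ⊕≈𝟘⇒≈- (≈-trans (≈-sym split) d≈𝟘) ⟩
        (- 1ℤ) ⊙ (- t j) ⊙ P i        ≈⟨ ⊙-assoc (- 1ℤ) (- t j) (P i) ⟨
        (- 1ℤ * - t j) ⊙ P i          ≈⟨ ⊙-congʳ-≡ (P i) (lemma (t j)) ⟩
        t j ⊙ P i                     ∎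
        where
        split : comb P (λ k → t i * δ j k + - t j * δ i k) ≈ t i ⊙ P j ⊕ (- t j) ⊙ P i
        split = ≈-trans (comb-+ P (λ k → t i * δ j k) (λ k → - t j * δ i k))
          (⊕-cong (comb-*δ P (t i) j) (comb-*δ P (- t j) i))
        lemma : ∀ x → - 1ℤ * - x ≡ x
        lemma = solve-∀

      -- The three relations `br-t` are the components of the formal cross product of `t` and `P`,
      -- and its vanishing is proportionality. Each cyclic pair of indices uses the component at the
      -- third index.
      collinear : ∀ i j → t i ⊙ P j ≈ t j ⊙ P i
      collinear 0F 0F = ≈-refl
      collinear 1F 1F = ≈-refl
      collinear 2F 2F = ≈-refl
      collinear 0F 1F = difference 0F 1F (≈-trans (comb-congʳ-≡ P same) (br-t 2F))
        where
        lemma-0 : ∀ x y z → x * 0ℤ + - y * 1ℤ ≡ x * 0ℤ + y * - 1ℤ + z * 0ℤ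
        lemma-0 = solve-∀
        lemma-1 : ∀ x y z → x * 1ℤ + - y * 0ℤ ≡ x * 1ℤ + y * 0ℤ + z * 0ℤ
        lemma-1 = solve-∀
        lemma-2 : ∀ x y z → x * 0ℤ + - y * 0ℤ ≡ x * 0ℤ + y * 0ℤ + z * 0ℤ
        lemma-2 = solve-∀
        same : ∀ k → t 0F * δ 1F k + - t 1F * δ 0F k ≡ sum₃ (λ j → t j * ε 2F j k)
        same 0F = lemma-0 (t 0F) (t 1F) (t 2F)
        same 1F = lemma-1 (t 0F) (t 1F) (t 2F)
        same 2F = lemma-2 (t 0F) (t 1F) (t 2F)
      collinear 1F 2F = difference 1F 2F (≈-trans (comb-congʳ-≡ P same) (br-t 0F))
        where
        lemma-0 : ∀ x y z → y * 0ℤ + - z * 0ℤ ≡ x * 0ℤ + y * 0ℤ + z * 0ℤ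
        lemma-0 = solve-∀
        lemma-1 : ∀ x y z → y * 0ℤ + - z * 1ℤ ≡ x * 0ℤ + y * 0ℤ + z * - 1ℤ
        lemma-1 = solve-∀
        lemma-2 : ∀ x y z → y * 1ℤ + - z * 0ℤ ≡ x * 0ℤ + y * 1ℤ + z * 0ℤ
        lemma-2 = solve-∀
        same : ∀ k → t 1F * δ 2F k + - t 2F * δ 1F k ≡ sum₃ (λ j → t j * ε 0F j k)
        same 0F = lemma-0 (t 0F) (t 1F) (t 2F)
        same 1F = lemma-1 (t 0F) (t 1F) (t 2F)
        same 2F = lemma-2 (t 0F) (t 1F) (t 2F)
      collinear 2F 0F = difference 2F 0F (≈-trans (comb-congʳ-≡ P same) (br-t 1F))
        where
        lemma-0 : ∀ x y z → z * 1ℤ + - x * 0ℤ ≡ x * 0ℤ + y * 0ℤ + z * 1ℤ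
        lemma-0 = solve-∀
        lemma-1 : ∀ x y z → z * 0ℤ + - x * 0ℤ ≡ x * 0ℤ + y * 0ℤ + z * 0ℤ
        lemma-1 = solve-∀
        lemma-2 : ∀ x y z → z * 0ℤ + - x * 1ℤ ≡ x * - 1ℤ + y * 0ℤ + z * 0ℤ
        lemma-2 = solve-∀
        same : ∀ k → t 2F * δ 0F k + - t 0F * δ 2F k ≡ sum₃ (λ j → t j * ε 1F j k)
        same 0F = lemma-0 (t 0F) (t 1F) (t 2F)
        same 1F = lemma-1 (t 0F) (t 1F) (t 2F)
        same 2F = lemma-2 (t 0F) (t 1F) (t 2F)
      collinear 1F 0F = ≈-sym (collinear 0F 1F)
      collinear 2F 1F = ≈-sym (collinear 1F 2F)
      collinear 0F 2F = ≈-sym (collinear 2F 0F)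

      module _ (k : Fin 3) (tₖ≄0 : ¬ t k ≋ 0ℤ) where

        m : Fin 3 → ℤ
        m i = sum₃ (λ j → M i j * t j)

        -- In the relation for `ξ i`, multiplied by `t k`, every `t k ⊙ P j` may be replaced by
        -- `t j ⊙ P k`. Only `P k` remains, with an entry of the product of `M` and `t` as
        -- coefficient.
        ξ-collinear : ∀ i → (t k * c i) ⊙ ξ i ≈ m i ⊙ P k
        ξ-collinear i = begin
          (t k * c i) ⊙ ξ i               ≈⟨ ⊙-assoc (t k) (c i) (ξ i) ⟩
          t k ⊙ c i ⊙ ξ i                 ≈⟨ ⊙-congˡ (t k) (ξ-relation i) ⟩
          t k ⊙ comb P (M i)              ≈⟨ comb-⊙ P (t k) (M i) ⟨
          comb (λ j → t k ⊙ P j) (M i)    ≈⟨ comb-congˡ (M i) (collinear k) ⟩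
          comb (λ j → t j ⊙ P k) (M i)    ≈⟨ comb-scaled (λ _ → P k) t (M i) ⟩
          comb (λ _ → P k) (λ j → M i j * t j)  ≈⟨ comb-const (P k) (λ j → M i j * t j) ⟩
          m i ⊙ P k                       ∎

        -- Up to the units `t k * c i`, all generators are multiples of the same `P k`, which
        -- commutes with itself.
        br-ξ≈𝟘 : ∀ i j → ⟦ ξ i , ξ j ⟧ ≈ 𝟘
        br-ξ≈𝟘 i j = ⊙≈𝟘⇒≈𝟘 (*-≄0 tₖ≄0 (c≄0 i)) (⊙≈𝟘⇒≈𝟘 (*-≄0 tₖ≄0 (c≄0 j)) (begin
          s j ⊙ s i ⊙ ⟦ ξ i , ξ j ⟧         ≈⟨ ⊙-congˡ (s j) (br-⊙ˡ (s i) (ξ i) (ξ j)) ⟨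
          s j ⊙ ⟦ s i ⊙ ξ i , ξ j ⟧         ≈⟨ br-⊙ʳ (s j) _ (ξ j) ⟨
          ⟦ s i ⊙ ξ i , s j ⊙ ξ j ⟧         ≈⟨ br-cong (ξ-collinear i) (ξ-collinear j) ⟩
          ⟦ m i ⊙ P k , m j ⊙ P k ⟧         ≈⟨ br-⊙ˡ (m i) (P k) _ ⟩
          m i ⊙ ⟦ P k , m j ⊙ P k ⟧         ≈⟨ ⊙-congˡ (m i) (br-⊙ʳ (m j) (P k) (P k)) ⟩
          m i ⊙ m j ⊙ ⟦ P k , P k ⟧         ≈⟨ ⊙-congˡ (m i) (⊙-congˡ (m j) (br-alt (P k))) ⟩
          m i ⊙ m j ⊙ 𝟘                     ≈⟨ ⊙-congˡ (m i) (⊙-zeroʳ (m j)) ⟩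
          m i ⊙ 𝟘                           ≈⟨ ⊙-zeroʳ (m i) ⟩
          𝟘                                 ∎))
          where
          s : Fin 3 → ℤ
          s i = t k * c i

        dependent⇒ξ≈𝟘 : ∀ i → ξ i ≈ 𝟘
        dependent⇒ξ≈𝟘 = P≈𝟘⇒ξ≈𝟘 λ
          { 0F → br-ξ≈𝟘 1F 2F
          ; 1F → br-ξ≈𝟘 2F 0F
          ; 2F → br-ξ≈𝟘 0F 1F
          }

  -- Linear independence of the generators forces the criterion.

  module Independent
    (c≄0 : ∀ i → ¬ c i ≋ 0ℤ)
    (independent : ∀ t → comb ξ t ≈ 𝟘 → ∀ k → t k ≋ 0ℤ)
    where

    ℓ₁₂ ℓ₁₃ ℓ₂₁ ℓ₂₃ ℓ₃₁ ℓ₃₂ : ℤ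
    ℓ₁₂ = ℓ 0F 1F
    ℓ₁₃ = ℓ 0F 2F
    ℓ₂₁ = ℓ 1F 0F
    ℓ₂₃ = ℓ 1F 2F
    ℓ₃₁ = ℓ 2F 0F
    ℓ₃₂ = ℓ 2F 1F

    det-M : ℤ
    det-M = ℓ₁₃ * ℓ₂₁ * ℓ₃₂ - ℓ₁₂ * ℓ₂₃ * ℓ₃₁

    -- This is the adjugate, already transposed: row `k` combines the relations so as to isolate
    -- `P k`. As `M` has zero diagonal, each cofactor is a single product of two linking numbers.
    adj-M : Fin 3 → Fin 3 → ℤ
    adj-M 0F = vec₃ (ℓ₂₁ * ℓ₃₁) (ℓ₁₂ * ℓ₃₁) (ℓ₁₃ * ℓ₂₁)
    adj-M 1F = vec₃ (ℓ₂₁ * ℓ₃₂) (ℓ₁₂ * ℓ₃₂) (ℓ₁₂ * ℓ₂₃)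
    adj-M 2F = vec₃ (ℓ₂₃ * ℓ₃₁) (ℓ₁₃ * ℓ₃₂) (ℓ₁₃ * ℓ₂₃)

    adj-M-M : ∀ k l → sum₃ (λ i → adj-M k i * M i l) ≡ det-M * δ k l
    adj-M-M = λ where
        0F 0F → lemma-00 ℓ₁₃ ℓ₁₂ ℓ₂₁ ℓ₂₃ ℓ₃₂ ℓ₃₁
        0F 1F → lemma-01 ℓ₁₃ ℓ₁₂ ℓ₂₁ ℓ₂₃ ℓ₃₂ ℓ₃₁
        0F 2F → lemma-02 ℓ₁₃ ℓ₁₂ ℓ₂₁ ℓ₂₃ ℓ₃₂ ℓ₃₁
        1F 0F → lemma-10 ℓ₁₃ ℓ₁₂ ℓ₂₁ ℓ₂₃ ℓ₃₂ ℓ₃₁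
        1F 1F → lemma-11 ℓ₁₃ ℓ₁₂ ℓ₂₁ ℓ₂₃ ℓ₃₂ ℓ₃₁
        1F 2F → lemma-12 ℓ₁₃ ℓ₁₂ ℓ₂₁ ℓ₂₃ ℓ₃₂ ℓ₃₁
        2F 0F → lemma-20 ℓ₁₃ ℓ₁₂ ℓ₂₁ ℓ₂₃ ℓ₃₂ ℓ₃₁
        2F 1F → lemma-21 ℓ₁₃ ℓ₁₂ ℓ₂₁ ℓ₂₃ ℓ₃₂ ℓ₃₁
        2F 2F → lemma-22 ℓ₁₃ ℓ₁₂ ℓ₂₁ ℓ₂₃ ℓ₃₂ ℓ₃₁
      where
      lemma-00 : ∀ a b d e f g → d * g * 0ℤ + b * g * - e + a * d * f ≡ (a * d * f - b * e * g) * 1ℤ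
      lemma-00 = solve-∀
      lemma-01 : ∀ a b d e f g → d * g * a + b * g * 0ℤ + a * d * - g ≡ (a * d * f - b * e * g) * 0ℤ
      lemma-01 = solve-∀
      lemma-02 : ∀ a b d e f g → d * g * - b + b * g * d + a * d * 0ℤ ≡ (a * d * f - b * e * g) * 0ℤ
      lemma-02 = solve-∀
      lemma-10 : ∀ a b d e f g → d * f * 0ℤ + b * f * - e + b * e * f ≡ (a * d * f - b * e * g) * 0ℤ
      lemma-10 = solve-∀
      lemma-11 : ∀ a b d e f g → d * f * a + b * f * 0ℤ + b * e * - g ≡ (a * d * f - b * e * g) * 1ℤ
      lemma-11 = solve-∀
      lemma-12 : ∀ a b d e f g → d * f * - b + b * f * d + b * e * 0ℤ ≡ (a * d * f - b * e * g) * 0ℤ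
      lemma-12 = solve-∀
      lemma-20 : ∀ a b d e f g → e * g * 0ℤ + a * f * - e + a * e * f ≡ (a * d * f - b * e * g) * 0ℤ
      lemma-20 = solve-∀
      lemma-21 : ∀ a b d e f g → e * g * a + a * f * 0ℤ + a * e * - g ≡ (a * d * f - b * e * g) * 0ℤ
      lemma-21 = solve-∀
      lemma-22 : ∀ a b d e f g → e * g * - b + a * f * d + a * e * 0ℤ ≡ (a * d * f - b * e * g) * 1ℤ
      lemma-22 = solve-∀

    N : Fin 3 → Fin 3 → ℤ
    N k i = adj-M k i * c i

    -- The adjugate solves the relations for `P` without dividing by `det-M`, so the formula can
    -- also be used to exclude a vanishing determinant.
    det-P : ∀ k → det-M ⊙ P k ≈ comb ξ (N k)
    det-P k = begin
      det-M ⊙ P k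
        ≈⟨ comb-*δ P det-M k ⟨
      comb P (λ l → det-M * δ k l)
        ≈⟨ comb-congʳ-≡ P (adj-M-M k) ⟨
      comb P (λ l → sum₃ (λ i → adj-M k i * M i l))
        ≈⟨ comb-comb P M (adj-M k) ⟨
      comb (λ i → comb P (M i)) (adj-M k)
        ≈⟨ comb-congˡ (adj-M k) ξ-relation ⟨
      comb (λ i → c i ⊙ ξ i) (adj-M k)
        ≈⟨ comb-scaled ξ c (adj-M k) ⟩
      comb ξ (N k) ∎

    -- A zero row would turn the `i`-th relation into `c i ⊙ ξ i ≈ 𝟘`, a dependence with a unit
    -- coefficient.
    M-row-≄0 : ∀ i → ¬ (∀ k → M i k ≋ 0ℤ)
    M-row-≄0 i Mᵢ≋0 = c≄0 i (c≋0 i (independent (λ j → c i * δ i j) cξ≈𝟘 i))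
      where
      cξ≈𝟘 : comb ξ (λ j → c i * δ i j) ≈ 𝟘
      cξ≈𝟘 = ≈-trans (comb-*δ ξ (c i) i) (≈-trans (ξ-relation i) (comb-≋0 P Mᵢ≋0))

      c≋0 : ∀ i → c i * δ i i ≋ 0ℤ → c i ≋ 0ℤ
      c≋0 0F = ≋-trans (≋-reflexive (sym (ℤ.*-identityʳ (c 0F))))
      c≋0 1F = ≋-trans (≋-reflexive (sym (ℤ.*-identityʳ (c 1F))))
      c≋0 2F = ≋-trans (≋-reflexive (sym (ℤ.*-identityʳ (c 2F))))

    -- When the determinant vanishes, `det-P` is a dependence with coefficients `adj-M k i * c i`,
    -- and the factor `c i` is a unit.
    det-M≋0⇒adj-M≋0 : det-M ≋ 0ℤ → ∀ k i → adj-M k i ≋ 0ℤ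
    det-M≋0⇒adj-M≋0 det≋0 k i = *≋0⇒≋0 (c≄0 i) (≋-trans
      (≋-reflexive (ℤ.*-comm (c i) (adj-M k i)))
      (independent (N k) (≈-trans (≈-sym (det-P k))
        (≈-trans (⊙-congʳ (P k) det≋0) (⊙-zeroˡ (P k)))) i))

    -- Since the adjugate consists of products of two linking numbers, a nonzero `ℓ₁₃` forces `ℓ₂₃`
    -- and `ℓ₂₁` to vanish, a nonzero `ℓ₁₂` forces `ℓ₃₂` and `ℓ₃₁` to vanish, and otherwise both are
    -- zero. In each case `M` acquires a zero row.
    det-M≄0 : ¬ det-M ≋ 0ℤ
    det-M≄0 det≋0 with ℓ₁₃ ≋? 0ℤ | ℓ₁₂ ≋? 0ℤ
    ... | no ℓ₁₃≄0 | _ = M-row-≄0 1F λ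
      { 0F → neg-cong (*≋0⇒≋0 ℓ₁₃≄0 (det-M≋0⇒adj-M≋0 det≋0 2F 2F))
      ; 1F → ≋-refl
      ; 2F → *≋0⇒≋0 ℓ₁₃≄0 (det-M≋0⇒adj-M≋0 det≋0 0F 2F)
      }
    ... | yes ℓ₁₃≋0 | no ℓ₁₂≄0 = M-row-≄0 2F λ
      { 0F → *≋0⇒≋0 ℓ₁₂≄0 (det-M≋0⇒adj-M≋0 det≋0 1F 1F)
      ; 1F → neg-cong (*≋0⇒≋0 ℓ₁₂≄0 (det-M≋0⇒adj-M≋0 det≋0 0F 1F))
      ; 2F → ≋-refl
      }
    ... | yes ℓ₁₃≋0 | yes ℓ₁₂≋0 = M-row-≄0 0F λ
      { 0F → ≋-refl
      ; 1F → ℓ₁₃≋0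
      ; 2F → neg-cong ℓ₁₂≋0
      }

    -- The adjugate of M scaled by c is, up to det M, the matrix expressing the Pₖ in the
    -- ξᵢ; the Jacobi identity says that its antisymmetric part κ vanishes.
    κ : Fin 3 → ℤ
    κ = vec₃ (N 1F 2F - N 2F 1F) (N 2F 0F - N 0F 2F) (N 0F 1F - N 1F 0F)

    -- Multiply the Jacobi identity of the generators by `det-M` and express each `det-M ⊙ P i` in
    -- the generators. Contracting `N` with the antisymmetric `ε` leaves `κ`.
    det-jacobi : comb P κ ≈ 𝟘
    det-jacobi = begin
      comb P κ
        ≈⟨ comb-congʳ-≡ P κ-entries ⟩
      comb P (λ k → sum₃ (λ i → sum₃ (λ j → N i j * ε i j k)))
        ≈⟨ Σ₃-comb P (λ i k → sum₃ (λ j → N i j * ε i j k)) ⟨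
      Σ₃ (λ i → comb P (λ k → sum₃ (λ j → N i j * ε i j k)))
        ≈⟨ Σ₃-cong (λ i → br-ξ-comb i (N i)) ⟨
      Σ₃ (λ i → ⟦ ξ i , comb ξ (N i) ⟧)
        ≈⟨ Σ₃-cong (λ i → br-cong (≈-refl {ξ i}) (det-P i)) ⟨
      Σ₃ (λ i → ⟦ ξ i , det-M ⊙ P i ⟧)
        ≈⟨ Σ₃-cong (λ i → br-⊙ʳ det-M (ξ i) (P i)) ⟩
      Σ₃ (λ i → det-M ⊙ ⟦ ξ i , P i ⟧)
        ≈⟨ ⊙-Σ₃ det-M (λ i → ⟦ ξ i , P i ⟧) ⟨
      det-M ⊙ Σ₃ (λ i → ⟦ ξ i , P i ⟧)
        ≈⟨ ⊙-congˡ det-M (jacobi (ξ 0F) (ξ 1F) (ξ 2F)) ⟩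
      det-M ⊙ 𝟘
        ≈⟨ ⊙-zeroʳ det-M ⟩
      𝟘 ∎
      where
      lemma-0 : ∀ x₀ x₁ x₂ y₀ y₁ y₂ z₀ z₁ z₂ → y₂ - z₁ ≡
        (x₀ * 0ℤ + x₁ * 0ℤ + x₂ * 0ℤ) + (y₀ * 0ℤ + y₁ * 0ℤ + y₂ * 1ℤ) + (z₀ * 0ℤ + z₁ * - 1ℤ + z₂ * 0ℤ)
      lemma-0 = solve-∀
      lemma-1 : ∀ x₀ x₁ x₂ y₀ y₁ y₂ z₀ z₁ z₂ → z₀ - x₂ ≡
        (x₀ * 0ℤ + x₁ * 0ℤ + x₂ * - 1ℤ) + (y₀ * 0ℤ + y₁ * 0ℤ + y₂ * 0ℤ) + (z₀ * 1ℤ + z₁ * 0ℤ + z₂ * 0ℤ)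
      lemma-1 = solve-∀
      lemma-2 : ∀ x₀ x₁ x₂ y₀ y₁ y₂ z₀ z₁ z₂ → x₁ - y₀ ≡
        (x₀ * 0ℤ + x₁ * 1ℤ + x₂ * 0ℤ) + (y₀ * - 1ℤ + y₁ * 0ℤ + y₂ * 0ℤ) + (z₀ * 0ℤ + z₁ * 0ℤ + z₂ * 0ℤ)
      lemma-2 = solve-∀

      κ-entries : ∀ k → κ k ≡ sum₃ (λ i → sum₃ (λ j → N i j * ε i j k))
      κ-entries 0F = lemma-0 (N 0F 0F) (N 0F 1F) (N 0F 2F) (N 1F 0F) (N 1F 1F) (N 1F 2F) (N 2F 0F) (N 2F 1F) (N 2F 2F)
      κ-entries 1F = lemma-1 (N 0F 0F) (N 0F 1F) (N 0F 2F) (N 1F 0F) (N 1F 1F) (N 1F 2F) (N 2F 0F) (N 2F 1F) (N 2F 2F)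
      κ-entries 2F = lemma-2 (N 0F 0F) (N 0F 1F) (N 0F 2F) (N 1F 0F) (N 1F 1F) (N 1F 2F) (N 2F 0F) (N 2F 1F) (N 2F 2F)

    -- Independence concerns the `ξ i`, so the relation among the `P k` is multiplied by `det-M` to
    -- become one among the `ξ i` with coefficient row `κ` times `N`. The factor `c j` of its `j`-th
    -- entry then cancels.
    κ-adj-M≋0 : ∀ j → sum₃ (λ k → κ k * adj-M k j) ≋ 0ℤ
    κ-adj-M≋0 j = *≋0⇒≋0 (c≄0 j) (≋-trans
      (≋-reflexive (lemma (κ 0F) (κ 1F) (κ 2F) (adj-M 0F j) (adj-M 1F j) (adj-M 2F j) (c j)))
      (independent (λ l → sum₃ (λ k → κ k * N k l)) κN≈𝟘 j))
      where
      lemma : ∀ x y z u v w c →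
        c * (x * u + y * v + z * w) ≡ x * (u * c) + y * (v * c) + z * (w * c)
      lemma = solve-∀

      κN≈𝟘 : comb ξ (λ l → sum₃ (λ k → κ k * N k l)) ≈ 𝟘
      κN≈𝟘 = begin
        comb ξ (λ l → sum₃ (λ k → κ k * N k l))  ≈⟨ comb-comb ξ N κ ⟨
        comb (λ k → comb ξ (N k)) κ              ≈⟨ comb-congˡ κ det-P ⟨
        comb (λ k → det-M ⊙ P k) κ               ≈⟨ comb-⊙ P det-M κ ⟩
        det-M ⊙ comb P κ                         ≈⟨ ⊙-congˡ det-M det-jacobi ⟩
        det-M ⊙ 𝟘                                ≈⟨ ⊙-zeroʳ det-M ⟩
        𝟘                                        ∎

    -- Multiplying the row `κ` times `adj-M` by `M` on the right recovers `det-M * κ k`, and `det-M`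
    -- is a unit.
    κ≋0 : ∀ k → κ k ≋ 0ℤ
    κ≋0 k = *≋0⇒≋0 det-M≄0 (≋-trans (≋-reflexive (det-κ k))
      (sum₃-*≋0 (λ j → sum₃ (λ i → κ i * adj-M i j)) (λ j → M j k) κ-adj-M≋0))
      where
      lemma-0 : ∀ a b d e f g x y z → (a * d * f - b * e * g) * x ≡
        (x * (d * g) + y * (d * f) + z * (e * g)) * 0ℤ +
        (x * (b * g) + y * (b * f) + z * (a * f)) * - e +
        (x * (a * d) + y * (b * e) + z * (a * e)) * f
      lemma-0 = solve-∀
      lemma-1 : ∀ a b d e f g x y z → (a * d * f - b * e * g) * y ≡
        (x * (d * g) + y * (d * f) + z * (e * g)) * a +
        (x * (b * g) + y * (b * f) + z * (a * f)) * 0ℤ +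
        (x * (a * d) + y * (b * e) + z * (a * e)) * - g
      lemma-1 = solve-∀
      lemma-2 : ∀ a b d e f g x y z → (a * d * f - b * e * g) * z ≡
        (x * (d * g) + y * (d * f) + z * (e * g)) * - b +
        (x * (b * g) + y * (b * f) + z * (a * f)) * d +
        (x * (a * d) + y * (b * e) + z * (a * e)) * 0ℤ
      lemma-2 = solve-∀

      det-κ : ∀ k → det-M * κ k ≡ sum₃ (λ j → sum₃ (λ i → κ i * adj-M i j) * M j k)
      det-κ 0F = lemma-0 ℓ₁₃ ℓ₁₂ ℓ₂₁ ℓ₂₃ ℓ₃₂ ℓ₃₁ (κ 0F) (κ 1F) (κ 2F)
      det-κ 1F = lemma-1 ℓ₁₃ ℓ₁₂ ℓ₂₁ ℓ₂₃ ℓ₃₂ ℓ₃₁ (κ 0F) (κ 1F) (κ 2F)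
      det-κ 2F = lemma-2 ℓ₁₃ ℓ₁₂ ℓ₂₁ ℓ₂₃ ℓ₃₂ ℓ₃₁ (κ 0F) (κ 1F) (κ 2F)

    -- The three combinations below are the off-diagonal entries of
    -- M (N - Nᵀ) Mᵀ = det M · (diag(c) Mᵀ - M diag(c)), up to sign.
    private
      κ-combination : ∀ (w : Fin 3 → ℤ) {x} → det-M * x ≡ sum₃ (λ k → κ k * w k) → x ≋ 0ℤ
      κ-combination w eq = *≋0⇒≋0 det-M≄0 (≋-trans (≋-reflexive eq) (sum₃-*≋0 κ w κ≋0))

    ℓ₁₃c₂+ℓ₂₃c₁≋0 : ℓ₁₃ * c 1F + ℓ₂₃ * c 0F ≋ 0ℤ
    ℓ₁₃c₂+ℓ₂₃c₁≋0 = κ-combination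
      -- The weights are minus column `2F` of `adj-M`: passing from an antisymmetric matrix `A` to
      -- `M A Mᵀ` acts on its axial vector by the transposed adjugate. Columns `0F` and `1F` serve
      -- the next two equations.
      (vec₃ (- (ℓ₁₃ * ℓ₂₁)) (- (ℓ₁₂ * ℓ₂₃)) (- (ℓ₁₃ * ℓ₂₃)))
      (lemma ℓ₁₃ ℓ₁₂ ℓ₂₁ ℓ₂₃ ℓ₃₂ ℓ₃₁ (c 0F) (c 1F) (c 2F))
      where
      lemma : ∀ a b d e f g x y z →
        (a * d * f - b * e * g) * (a * y + e * x) ≡
        (b * e * z - a * f * y) * - (a * d) +
        (e * g * x - a * d * z) * - (b * e) +
        (b * g * y - d * f * x) * - (a * e)
      lemma = solve-∀

    ℓ₂₁c₃+ℓ₃₁c₂≋0 : ℓ₂₁ * c 2F + ℓ₃₁ * c 1F ≋ 0ℤ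
    ℓ₂₁c₃+ℓ₃₁c₂≋0 = κ-combination
      (vec₃ (- (ℓ₂₁ * ℓ₃₁)) (- (ℓ₂₁ * ℓ₃₂)) (- (ℓ₂₃ * ℓ₃₁)))
      (lemma ℓ₁₃ ℓ₁₂ ℓ₂₁ ℓ₂₃ ℓ₃₂ ℓ₃₁ (c 0F) (c 1F) (c 2F))
      where
      lemma : ∀ a b d e f g x y z →
        (a * d * f - b * e * g) * (d * z + g * y) ≡
        (b * e * z - a * f * y) * - (d * g) +
        (e * g * x - a * d * z) * - (d * f) +
        (b * g * y - d * f * x) * - (e * g)
      lemma = solve-∀

    ℓ₁₂c₃+ℓ₃₂c₁≋0 : ℓ₁₂ * c 2F + ℓ₃₂ * c 0F ≋ 0ℤ
    ℓ₁₂c₃+ℓ₃₂c₁≋0 = κ-combination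
      (vec₃ (- (ℓ₁₂ * ℓ₃₁)) (- (ℓ₁₂ * ℓ₃₂)) (- (ℓ₁₃ * ℓ₃₂)))
      (lemma ℓ₁₃ ℓ₁₂ ℓ₂₁ ℓ₂₃ ℓ₃₂ ℓ₃₁ (c 0F) (c 1F) (c 2F))
      where
      lemma : ∀ a b d e f g x y z →
        (a * d * f - b * e * g) * (b * z + f * x) ≡
        (b * e * z - a * f * y) * - (b * g) +
        (e * g * x - a * d * z) * - (b * f) +
        (b * g * y - d * f * x) * - (a * f)
      lemma = solve-∀

    private
      -- As `det-M` is a combination of `x` and `y`, they cannot both vanish; but the linear
      -- equation with units `u` and `v` makes either vanish with the other. It applies because each
      -- of the two monomials of `det-M` contains exactly one member of each pair of linking
      -- numbers.
      both-≄0 : ∀ {x y u v} X Y → det-M ≡ x * X + y * Y → x * u + y * v ≋ 0ℤ →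
        ¬ u ≋ 0ℤ → ¬ v ≋ 0ℤ → ¬ x ≋ 0ℤ × ¬ y ≋ 0ℤ
      both-≄0 {x} {y} {u} {v} X Y det≡ xu+yv≋0 u≄0 v≄0 = x≄0 , y≄0
        where
        x,y≄0 : x ≋ 0ℤ → ¬ y ≋ 0ℤ
        x,y≄0 x≋0 y≋0 =
          det-M≄0 (≋-trans (≋-reflexive det≡) (+-≋0 (*-≋0ʳ X x≋0) (*-≋0ʳ Y y≋0)))

        lemma-x : ∀ x y u v → u * x ≡ (x * u + y * v) + - v * y
        lemma-x = solve-∀

        lemma-y : ∀ x y u v → v * y ≡ (x * u + y * v) + - u * x
        lemma-y = solve-∀

        x≄0 : ¬ x ≋ 0ℤ
        x≄0 x≋0 = x,y≄0 x≋0 (*≋0⇒≋0 v≄0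
          (≋-trans (≋-reflexive (lemma-y x y u v)) (+-≋0 xu+yv≋0 (*-≋0ˡ (- u) x≋0))))

        y≄0 : ¬ y ≋ 0ℤ
        y≄0 y≋0 = x,y≄0 (*≋0⇒≋0 u≄0
          (≋-trans (≋-reflexive (lemma-x x y u v)) (+-≋0 xu+yv≋0 (*-≋0ˡ (- v) y≋0)))) y≋0

    ℓ₁₃,ℓ₂₃≄0 : ¬ ℓ₁₃ ≋ 0ℤ × ¬ ℓ₂₃ ≋ 0ℤ
    ℓ₁₃,ℓ₂₃≄0 = both-≄0 (ℓ₂₁ * ℓ₃₂) (- (ℓ₁₂ * ℓ₃₁)) (lemma ℓ₁₃ ℓ₁₂ ℓ₂₁ ℓ₂₃ ℓ₃₂ ℓ₃₁)
      ℓ₁₃c₂+ℓ₂₃c₁≋0 (c≄0 1F) (c≄0 0F)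
      where
      lemma : ∀ a b d e f g → a * d * f - b * e * g ≡ a * (d * f) + e * - (b * g)
      lemma = solve-∀

    ℓ₂₁,ℓ₃₁≄0 : ¬ ℓ₂₁ ≋ 0ℤ × ¬ ℓ₃₁ ≋ 0ℤ
    ℓ₂₁,ℓ₃₁≄0 = both-≄0 (ℓ₁₃ * ℓ₃₂) (- (ℓ₁₂ * ℓ₂₃)) (lemma ℓ₁₃ ℓ₁₂ ℓ₂₁ ℓ₂₃ ℓ₃₂ ℓ₃₁)
      ℓ₂₁c₃+ℓ₃₁c₂≋0 (c≄0 2F) (c≄0 1F)
      where
      lemma : ∀ a b d e f g → a * d * f - b * e * g ≡ d * (a * f) + g * - (b * e)
      lemma = solve-∀

    ℓ₁₂,ℓ₃₂≄0 : ¬ ℓ₁₂ ≋ 0ℤ × ¬ ℓ₃₂ ≋ 0ℤ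
    ℓ₁₂,ℓ₃₂≄0 = both-≄0 (- (ℓ₂₃ * ℓ₃₁)) (ℓ₁₃ * ℓ₂₁) (lemma ℓ₁₃ ℓ₁₂ ℓ₂₁ ℓ₂₃ ℓ₃₂ ℓ₃₁)
      ℓ₁₂c₃+ℓ₃₂c₁≋0 (c≄0 2F) (c≄0 0F)
      where
      lemma : ∀ a b d e f g → a * d * f - b * e * g ≡ b * - (e * g) + f * (a * d)
      lemma = solve-∀

    ℓ≄0 : ∀ i j → i ≢ j → ¬ ℓ i j ≋ 0ℤ
    ℓ≄0 0F 0F i≢j = ⊥-elim (i≢j refl)
    ℓ≄0 1F 1F i≢j = ⊥-elim (i≢j refl)
    ℓ≄0 2F 2F i≢j = ⊥-elim (i≢j refl)
    ℓ≄0 0F 1F _ = proj₁ ℓ₁₂,ℓ₃₂≄0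
    ℓ≄0 0F 2F _ = proj₁ ℓ₁₃,ℓ₂₃≄0
    ℓ≄0 1F 0F _ = proj₁ ℓ₂₁,ℓ₃₁≄0
    ℓ≄0 1F 2F _ = proj₂ ℓ₁₃,ℓ₂₃≄0
    ℓ≄0 2F 0F _ = proj₂ ℓ₂₁,ℓ₃₁≄0
    ℓ≄0 2F 1F _ = proj₂ ℓ₁₂,ℓ₃₂≄0

  -- From failure of the property to the criterion.

  ξ≈𝟘⇒≈𝟘 : (∀ i → ξ i ≈ 𝟘) → ∀ x → x ≈ 𝟘
  ξ≈𝟘⇒≈𝟘 ξ≈𝟘 (ξ i)      = ξ≈𝟘 i
  ξ≈𝟘⇒≈𝟘 ξ≈𝟘 𝟘          = ≈-refl
  ξ≈𝟘⇒≈𝟘 ξ≈𝟘 (x ⊕ y)    = ≈-trans (⊕-cong (ξ≈𝟘⇒≈𝟘 ξ≈𝟘 x) (ξ≈𝟘⇒≈𝟘 ξ≈𝟘 y)) (⊕-idʳ 𝟘)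
  ξ≈𝟘⇒≈𝟘 ξ≈𝟘 (a ⊙ x)    = ≈-trans (⊙-congˡ a (ξ≈𝟘⇒≈𝟘 ξ≈𝟘 x)) (⊙-zeroʳ a)
  ξ≈𝟘⇒≈𝟘 ξ≈𝟘 ⟦ x , y ⟧  = ≈-trans (br-cong (ξ≈𝟘⇒≈𝟘 ξ≈𝟘 x) ≈-refl) (br-zeroˡ y)

  -- Every term equals `0ℤ ⊙ 𝟘`, whose image vanishes by homogeneity of `φ`.
  ξ≈𝟘⇒FM : ∀ n → (∀ i → ξ i ≈ 𝟘) → FM n
  ξ≈𝟘⇒FM n ξ≈𝟘 φ φ-hom x i j = ≋⇒≡mod {φ x i j} (≋-trans
    (≡mod⇒≋ {φ x i j} {φ (0ℤ ⊙ 𝟘) i j}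
      (resp (≈-trans (ξ≈𝟘⇒≈𝟘 ξ≈𝟘 x) (≈-sym (⊙-zeroˡ 𝟘))) i j))
    (≡mod⇒≋ {φ (0ℤ ⊙ 𝟘) i j} {0ℤ} (hom-⊙ 0ℤ 𝟘 i j)))
    where open IsLieHom φ-hom

  -- The conclusion is decidable, so it suffices to refute a nonzero coefficient, and such a
  -- coefficient makes all generators vanish.
  ξ≉𝟘⇒independent : (∀ i → ¬ c i ≋ 0ℤ) → ¬ (∀ i → ξ i ≈ 𝟘) →
    ∀ t → comb ξ t ≈ 𝟘 → ∀ k → t k ≋ 0ℤ
  ξ≉𝟘⇒independent c≄0 ξ≉𝟘 t t≈𝟘 k =
    decidable-stable (t k ≋? 0ℤ) (λ tₖ≄0 → ξ≉𝟘 (Dependent.dependent⇒ξ≈𝟘 c≄0 t t≈𝟘 k tₖ≄0))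

  ¬FM⇒criterion : (∀ i → ¬ c i ≋ 0ℤ) → ∀ n → ¬ FM n → RepresentationCriterion p c ℓ
  ¬FM⇒criterion c≄0 n ¬fm =
      (λ i j i≢j ℓᵢⱼ≡0 → ℓ≄0 i j i≢j (≡mod⇒≋ {ℓ i j} {0ℤ} ℓᵢⱼ≡0))
    , ≋⇒≡mod (+≋0⇒≋- {ℓ 0F 2F * c 1F} {ℓ 1F 2F * c 0F} ℓ₁₃c₂+ℓ₂₃c₁≋0)
    , ≋⇒≡mod (+≋0⇒≋- {ℓ 1F 0F * c 2F} {ℓ 2F 0F * c 1F} ℓ₂₁c₃+ℓ₃₁c₂≋0)
    , ≋⇒≡mod (+≋0⇒≋- {ℓ 0F 1F * c 2F} {ℓ 2F 1F * c 0F} ℓ₁₂c₃+ℓ₃₂c₁≋0)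
    where
    open Independent c≄0 (ξ≉𝟘⇒independent c≄0 (¬fm ∘ ξ≈𝟘⇒FM n))

-- The Lie algebra sl₂ and its block matrices.

-- sl₂ in the basis E, H, F. Unfolding the integer operations nested in iterated
-- brackets makes conversion checking explode, hence opaque.
opaque

  br-sl₂ : (Fin 3 → ℤ) → (Fin 3 → ℤ) → Fin 3 → ℤ
  br-sl₂ v w = vec₃ (+ 2 * (v 1F * w 0F - w 1F * v 0F))
                    (v 0F * w 2F - w 0F * v 2F)
                    (+ 2 * (w 1F * v 2F - v 1F * w 2F))

-- sl₂ acting on the first two coordinates of the (2 + m)-dimensional space.
embed : ∀ {m} → (Fin 3 → ℤ) → Mat (2 ℕ.+ m)
embed v 0F            0F            = v 1F
embed v 0F            1F            = v 0F
embed v 1F            0F            = v 2F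
embed v 1F            1F            = - v 1F
embed v 0F            (suc (suc _)) = 0ℤ
embed v 1F            (suc (suc _)) = 0ℤ
embed v (suc (suc _)) _             = 0ℤ

embed-+ : ∀ {m} v w i j →
  embed {m} (λ k → v k + w k) i j ≡ embed {m} v i j + embed {m} w i j
embed-+ v w 0F            0F            = refl
embed-+ v w 0F            1F            = refl
embed-+ v w 1F            0F            = refl
embed-+ v w 1F            1F            = ℤ.neg-distrib-+ (v 1F) (w 1F)
embed-+ v w 0F            (suc (suc _)) = refl
embed-+ v w 1F            (suc (suc _)) = refl
embed-+ v w (suc (suc _)) _             = refl

embed-* : ∀ {m} a v i j → embed {m} (λ k → a * v k) i j ≡ a * embed {m} v i j
embed-* a v 0F            0F            = refl
embed-* a v 0F            1F            = refl
embed-* a v 1F            0F            = refl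
embed-* a v 1F            1F            = ℤ.neg-distribʳ-* a (v 1F)
embed-* a v 0F            (suc (suc _)) = sym (ℤ.*-zeroʳ a)
embed-* a v 1F            (suc (suc _)) = sym (ℤ.*-zeroʳ a)
embed-* a v (suc (suc _)) _             = sym (ℤ.*-zeroʳ a)

ΣFin-zero : ∀ n (f : Fin n → ℤ) → (∀ i → f i ≡ 0ℤ) → ΣFin n f ≡ 0ℤ
ΣFin-zero zero    f f≡0 = refl
ΣFin-zero (suc n) f f≡0 = cong₂ _+_ (f≡0 zero) (ΣFin-zero n (f ∘ suc) (f≡0 ∘ suc))

-- The rows of `embed w` after the second are zero, so two terms of the sum survive.
embed-*ₘ : ∀ {m} v w (i j : Fin (2 ℕ.+ m)) → (embed v *ₘ embed w) i j ≡
  embed {m} v i 0F * embed {m} w 0F j + embed {m} v i 1F * embed {m} w 1F j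
embed-*ₘ {m} v w i j = cong (λ z → embed {m} v i 0F * embed {m} w 0F j + z)
  (trans (cong (λ z → embed {m} v i 1F * embed {m} w 1F j + z)
    (ΣFin-zero m (λ k → embed {m} v i (suc (suc k)) * embed {m} w (suc (suc k)) j)
      (λ k → ℤ.*-zeroʳ (embed {m} v i (suc (suc k))))))
  (ℤ.+-identityʳ _))

opaque
  unfolding br-sl₂

  br-sl₂-+ˡ : ∀ u v w k → br-sl₂ (λ i → u i + v i) w k ≡ br-sl₂ u w k + br-sl₂ v w k
  br-sl₂-+ˡ u v w = λ where
      0F → lemma-e (u 0F) (u 1F) (v 0F) (v 1F) (w 0F) (w 1F)
      1F → lemma-h (u 0F) (u 2F) (v 0F) (v 2F) (w 0F) (w 2F)
      2F → lemma-f (u 1F) (u 2F) (v 1F) (v 2F) (w 1F) (w 2F)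
    where
    lemma-e : ∀ x₀ x₁ y₀ y₁ z₀ z₁ → + 2 * ((x₁ + y₁) * z₀ - z₁ * (x₀ + y₀)) ≡
      + 2 * (x₁ * z₀ - z₁ * x₀) + + 2 * (y₁ * z₀ - z₁ * y₀)
    lemma-e = solve-∀
    lemma-h : ∀ x₀ x₂ y₀ y₂ z₀ z₂ → (x₀ + y₀) * z₂ - z₀ * (x₂ + y₂) ≡
      (x₀ * z₂ - z₀ * x₂) + (y₀ * z₂ - z₀ * y₂)
    lemma-h = solve-∀
    lemma-f : ∀ x₁ x₂ y₁ y₂ z₁ z₂ → + 2 * (z₁ * (x₂ + y₂) - (x₁ + y₁) * z₂) ≡
      + 2 * (z₁ * x₂ - x₁ * z₂) + + 2 * (z₁ * y₂ - y₁ * z₂)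
    lemma-f = solve-∀

  br-sl₂-+ʳ : ∀ u v w k → br-sl₂ u (λ i → v i + w i) k ≡ br-sl₂ u v k + br-sl₂ u w k
  br-sl₂-+ʳ u v w = λ where
      0F → lemma-e (u 0F) (u 1F) (v 0F) (v 1F) (w 0F) (w 1F)
      1F → lemma-h (u 0F) (u 2F) (v 0F) (v 2F) (w 0F) (w 2F)
      2F → lemma-f (u 1F) (u 2F) (v 1F) (v 2F) (w 1F) (w 2F)
    where
    lemma-e : ∀ x₀ x₁ y₀ y₁ z₀ z₁ → + 2 * (x₁ * (y₀ + z₀) - (y₁ + z₁) * x₀) ≡
      + 2 * (x₁ * y₀ - y₁ * x₀) + + 2 * (x₁ * z₀ - z₁ * x₀)
    lemma-e = solve-∀
    lemma-h : ∀ x₀ x₂ y₀ y₂ z₀ z₂ → x₀ * (y₂ + z₂) - (y₀ + z₀) * x₂ ≡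
      (x₀ * y₂ - y₀ * x₂) + (x₀ * z₂ - z₀ * x₂)
    lemma-h = solve-∀
    lemma-f : ∀ x₁ x₂ y₁ y₂ z₁ z₂ → + 2 * ((y₁ + z₁) * x₂ - x₁ * (y₂ + z₂)) ≡
      + 2 * (y₁ * x₂ - x₁ * y₂) + + 2 * (z₁ * x₂ - x₁ * z₂)
    lemma-f = solve-∀

  br-sl₂-*ˡ : ∀ a u v k → br-sl₂ (λ i → a * u i) v k ≡ a * br-sl₂ u v k
  br-sl₂-*ˡ a u v = λ where
      0F → lemma-e a (u 0F) (u 1F) (v 0F) (v 1F)
      1F → lemma-h a (u 0F) (u 2F) (v 0F) (v 2F)
      2F → lemma-f a (u 1F) (u 2F) (v 1F) (v 2F)
    where
    lemma-e : ∀ a x₀ x₁ y₀ y₁ →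
      + 2 * (a * x₁ * y₀ - y₁ * (a * x₀)) ≡ a * (+ 2 * (x₁ * y₀ - y₁ * x₀))
    lemma-e = solve-∀
    lemma-h : ∀ a x₀ x₂ y₀ y₂ →
      a * x₀ * y₂ - y₀ * (a * x₂) ≡ a * (x₀ * y₂ - y₀ * x₂)
    lemma-h = solve-∀
    lemma-f : ∀ a x₁ x₂ y₁ y₂ →
      + 2 * (y₁ * (a * x₂) - a * x₁ * y₂) ≡ a * (+ 2 * (y₁ * x₂ - x₁ * y₂))
    lemma-f = solve-∀

  br-sl₂-*ʳ : ∀ a u v k → br-sl₂ u (λ i → a * v i) k ≡ a * br-sl₂ u v k
  br-sl₂-*ʳ a u v = λ where
      0F → lemma-e a (u 0F) (u 1F) (v 0F) (v 1F)
      1F → lemma-h a (u 0F) (u 2F) (v 0F) (v 2F)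
      2F → lemma-f a (u 1F) (u 2F) (v 1F) (v 2F)
    where
    lemma-e : ∀ a x₀ x₁ y₀ y₁ →
      + 2 * (x₁ * (a * y₀) - a * y₁ * x₀) ≡ a * (+ 2 * (x₁ * y₀ - y₁ * x₀))
    lemma-e = solve-∀
    lemma-h : ∀ a x₀ x₂ y₀ y₂ →
      x₀ * (a * y₂) - a * y₀ * x₂ ≡ a * (x₀ * y₂ - y₀ * x₂)
    lemma-h = solve-∀
    lemma-f : ∀ a x₁ x₂ y₁ y₂ →
      + 2 * (a * y₁ * x₂ - x₁ * (a * y₂)) ≡ a * (+ 2 * (y₁ * x₂ - x₁ * y₂))
    lemma-f = solve-∀

  br-sl₂-alt : ∀ u k → br-sl₂ u u k ≡ 0ℤ
  br-sl₂-alt u = λ where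
      0F → lemma-ef (u 1F) (u 0F)
      1F → ℤ.+-inverseʳ (u 0F * u 2F)
      2F → lemma-ef (u 1F) (u 2F)
    where
    lemma-ef : ∀ x y → + 2 * (x * y - x * y) ≡ 0ℤ
    lemma-ef = solve-∀

  -- Coordinates of inner brackets enter the component identities as variables with defining
  -- equations, which keeps each identity small until the solver expands it.
  br-sl₂-jacobi : ∀ u v w k →
    br-sl₂ u (br-sl₂ v w) k + br-sl₂ v (br-sl₂ w u) k + br-sl₂ w (br-sl₂ u v) k ≡ 0ℤ
  br-sl₂-jacobi u v w = λ where
      0F → lemma-e (u 0F) (u 1F) (u 2F) (v 0F) (v 1F) (v 2F) (w 0F) (w 1F) (w 2F)
        (br-sl₂ v w 0F) (br-sl₂ v w 1F) (br-sl₂ w u 0F) (br-sl₂ w u 1F) (br-sl₂ u v 0F) (br-sl₂ u v 1F)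
        refl refl refl refl refl refl
      1F → lemma-h (u 0F) (u 1F) (u 2F) (v 0F) (v 1F) (v 2F) (w 0F) (w 1F) (w 2F)
        (br-sl₂ v w 0F) (br-sl₂ v w 2F) (br-sl₂ w u 0F) (br-sl₂ w u 2F) (br-sl₂ u v 0F) (br-sl₂ u v 2F)
        refl refl refl refl refl refl
      2F → lemma-f (u 0F) (u 1F) (u 2F) (v 0F) (v 1F) (v 2F) (w 0F) (w 1F) (w 2F)
        (br-sl₂ v w 1F) (br-sl₂ v w 2F) (br-sl₂ w u 1F) (br-sl₂ w u 2F) (br-sl₂ u v 1F) (br-sl₂ u v 2F)
        refl refl refl refl refl refl
    where
    lemma-e : ∀ x₀ x₁ x₂ y₀ y₁ y₂ z₀ z₁ z₂ yz₀ yz₁ zx₀ zx₁ xy₀ xy₁ →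
      yz₀ ≡ + 2 * (y₁ * z₀ - z₁ * y₀) → yz₁ ≡ y₀ * z₂ - z₀ * y₂ →
      zx₀ ≡ + 2 * (z₁ * x₀ - x₁ * z₀) → zx₁ ≡ z₀ * x₂ - x₀ * z₂ →
      xy₀ ≡ + 2 * (x₁ * y₀ - y₁ * x₀) → xy₁ ≡ x₀ * y₂ - y₀ * x₂ →
      (+ 2 * (x₁ * yz₀ - yz₁ * x₀)) + (+ 2 * (y₁ * zx₀ - zx₁ * y₀)) + (+ 2 * (z₁ * xy₀ - xy₁ * z₀)) ≡ 0ℤ
    lemma-e x₀ x₁ x₂ y₀ y₁ y₂ z₀ z₁ z₂ _ _ _ _ _ _ refl refl refl refl refl refl =
      solve (x₀ ∷ x₁ ∷ x₂ ∷ y₀ ∷ y₁ ∷ y₂ ∷ z₀ ∷ z₁ ∷ z₂ ∷ [])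
    lemma-h : ∀ x₀ x₁ x₂ y₀ y₁ y₂ z₀ z₁ z₂ yz₀ yz₂ zx₀ zx₂ xy₀ xy₂ →
      yz₀ ≡ + 2 * (y₁ * z₀ - z₁ * y₀) → yz₂ ≡ + 2 * (z₁ * y₂ - y₁ * z₂) →
      zx₀ ≡ + 2 * (z₁ * x₀ - x₁ * z₀) → zx₂ ≡ + 2 * (x₁ * z₂ - z₁ * x₂) →
      xy₀ ≡ + 2 * (x₁ * y₀ - y₁ * x₀) → xy₂ ≡ + 2 * (y₁ * x₂ - x₁ * y₂) →
      (x₀ * yz₂ - yz₀ * x₂) + (y₀ * zx₂ - zx₀ * y₂) + (z₀ * xy₂ - xy₀ * z₂) ≡ 0ℤ
    lemma-h x₀ x₁ x₂ y₀ y₁ y₂ z₀ z₁ z₂ _ _ _ _ _ _ refl refl refl refl refl refl =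
      solve (x₀ ∷ x₁ ∷ x₂ ∷ y₀ ∷ y₁ ∷ y₂ ∷ z₀ ∷ z₁ ∷ z₂ ∷ [])
    lemma-f : ∀ x₀ x₁ x₂ y₀ y₁ y₂ z₀ z₁ z₂ yz₁ yz₂ zx₁ zx₂ xy₁ xy₂ →
      yz₁ ≡ y₀ * z₂ - z₀ * y₂ → yz₂ ≡ + 2 * (z₁ * y₂ - y₁ * z₂) →
      zx₁ ≡ z₀ * x₂ - x₀ * z₂ → zx₂ ≡ + 2 * (x₁ * z₂ - z₁ * x₂) →
      xy₁ ≡ x₀ * y₂ - y₀ * x₂ → xy₂ ≡ + 2 * (y₁ * x₂ - x₁ * y₂) →
      (+ 2 * (yz₁ * x₂ - x₁ * yz₂)) + (+ 2 * (zx₁ * y₂ - y₁ * zx₂)) + (+ 2 * (xy₁ * z₂ - z₁ * xy₂)) ≡ 0ℤ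
    lemma-f x₀ x₁ x₂ y₀ y₁ y₂ z₀ z₁ z₂ _ _ _ _ _ _ refl refl refl refl refl refl =
      solve (x₀ ∷ x₁ ∷ x₂ ∷ y₀ ∷ y₁ ∷ y₂ ∷ z₀ ∷ z₁ ∷ z₂ ∷ [])

  -- This exposes the bracket of explicit vectors to the computations in which `br-sl₂` stays
  -- opaque.
  br-sl₂-vec₃ : ∀ a b c d e f k → br-sl₂ (vec₃ a b c) (vec₃ d e f) k ≡
    vec₃ (+ 2 * (b * d - e * a)) (a * f - d * c) (+ 2 * (e * c - b * f)) k
  br-sl₂-vec₃ a b c d e f = λ where
    0F → refl
    1F → refl
    2F → refl

  embed-br : ∀ {m} v w (i j : Fin (2 ℕ.+ m)) →
    embed (br-sl₂ v w) i j ≡ ⁅ embed v , embed w ⁆ₘ i j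
  embed-br {m} v w i j = trans (entries i j)
    (sym (cong₂ _-_ (embed-*ₘ {m} v w i j) (embed-*ₘ {m} w v i j)))
    where
    lemma-00 : ∀ v₀ v₁ v₂ w₀ w₁ w₂ →
      v₀ * w₂ - w₀ * v₂ ≡ (v₁ * w₁ + v₀ * w₂) - (w₁ * v₁ + w₀ * v₂)
    lemma-00 = solve-∀
    lemma-01 : ∀ v₀ v₁ w₀ w₁ →
      + 2 * (v₁ * w₀ - w₁ * v₀) ≡ (v₁ * w₀ + v₀ * - w₁) - (w₁ * v₀ + w₀ * - v₁)
    lemma-01 = solve-∀
    lemma-10 : ∀ v₁ v₂ w₁ w₂ →
      + 2 * (w₁ * v₂ - v₁ * w₂) ≡ (v₂ * w₁ + - v₁ * w₂) - (w₂ * v₁ + - w₁ * v₂)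
    lemma-10 = solve-∀
    lemma-11 : ∀ v₀ v₁ v₂ w₀ w₁ w₂ →
      - (v₀ * w₂ - w₀ * v₂) ≡ (v₂ * w₀ + - v₁ * - w₁) - (w₂ * v₀ + - w₁ * - v₁)
    lemma-11 = solve-∀
    lemma-0 : ∀ x y z t → 0ℤ ≡ (x * 0ℤ + y * 0ℤ) - (z * 0ℤ + t * 0ℤ)
    lemma-0 = solve-∀

    entries : ∀ i j → embed {m} (br-sl₂ v w) i j ≡
      (embed {m} v i 0F * embed {m} w 0F j + embed {m} v i 1F * embed {m} w 1F j) -
      (embed {m} w i 0F * embed {m} v 0F j + embed {m} w i 1F * embed {m} v 1F j)
    entries 0F 0F = lemma-00 (v 0F) (v 1F) (v 2F) (w 0F) (w 1F) (w 2F)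
    entries 0F 1F = lemma-01 (v 0F) (v 1F) (w 0F) (w 1F)
    entries 1F 0F = lemma-10 (v 1F) (v 2F) (w 1F) (w 2F)
    entries 1F 1F = lemma-11 (v 0F) (v 1F) (v 2F) (w 0F) (w 1F) (w 2F)
    entries 0F (suc (suc _)) = lemma-0 (v 1F) (v 0F) (w 1F) (w 0F)
    entries 1F (suc (suc _)) = lemma-0 (v 2F) (- v 1F) (w 2F) (- w 1F)
    entries (suc (suc _)) _ = refl

-- A nonzero representation under the criterion.

module Representation
  (p : ℕ) (p-prime : Prime p) (c : Fin 3 → ℤ) (ℓ : Fin 3 → Fin 3 → ℤ) where

  open PrimeField p p-prime
  open LinkingAlgebra p c ℓ

  opaque
    unfolding br-sl₂

    br-sl₂-cong : ∀ {v v′ w w′} → (∀ k → v k ≋ v′ k) → (∀ k → w k ≋ w′ k) →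
      ∀ k → br-sl₂ v w k ≋ br-sl₂ v′ w′ k
    br-sl₂-cong v w 0F =
      *-congˡ (+ 2) (+-cong (*-cong (v 1F) (w 0F)) (neg-cong (*-cong (w 1F) (v 0F))))
    br-sl₂-cong v w 1F =
      +-cong (*-cong (v 0F) (w 2F)) (neg-cong (*-cong (w 0F) (v 2F)))
    br-sl₂-cong v w 2F =
      *-congˡ (+ 2) (+-cong (*-cong (w 1F) (v 2F)) (neg-cong (*-cong (v 1F) (w 2F))))

  module Evaluation (X : Fin 3 → Fin 3 → ℤ) where

    ρ : LTerm → Fin 3 → ℤ
    ρ (ξ i)     k = X i k
    ρ 𝟘         k = 0ℤ
    ρ (x ⊕ y)   k = ρ x k + ρ y k
    ρ (a ⊙ x)   k = a * ρ x k
    ρ ⟦ x , y ⟧ k = br-sl₂ (ρ x) (ρ y) k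

    module _ (ρ-rel : ∀ i k → ρ (linkRel c ℓ i) k ≋ 0ℤ) where

      -- The Lie algebra axioms hold exactly over the integers in sl₂; proper congruences modulo `p`
      -- arise from `⊙-cong` and `rel`.
      ρ-resp : ∀ {x y} → x ≈ y → ∀ k → ρ x k ≋ ρ y k
      ρ-resp refl k = ≋-refl
      ρ-resp (sym x≈y) k = ≋-sym (ρ-resp x≈y k)
      ρ-resp (trans x≈y y≈z) k = ≋-trans (ρ-resp x≈y k) (ρ-resp y≈z k)
      ρ-resp (⊕-cong x≈x′ y≈y′) k = +-cong (ρ-resp x≈x′ k) (ρ-resp y≈y′ k)
      ρ-resp (⊙-cong {a} {b} a≡b x≈y) k = *-cong (≡mod⇒≋ {a} {b} a≡b) (ρ-resp x≈y k)
      ρ-resp (br-cong x≈x′ y≈y′) k = br-sl₂-cong (ρ-resp x≈x′) (ρ-resp y≈y′) k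
      ρ-resp (⊕-assoc x y z) k = ≋-reflexive (ℤ.+-assoc (ρ x k) (ρ y k) (ρ z k))
      ρ-resp (⊕-comm x y) k = ≋-reflexive (ℤ.+-comm (ρ x k) (ρ y k))
      ρ-resp (⊕-idʳ x) k = ≋-reflexive (ℤ.+-identityʳ (ρ x k))
      ρ-resp (⊕-invʳ x) k = ≋-reflexive (lemma (ρ x k))
        where
        lemma : ∀ x → x + - 1ℤ * x ≡ 0ℤ
        lemma = solve-∀
      ρ-resp (⊙-one x) k = ≋-reflexive (ℤ.*-identityˡ (ρ x k))
      ρ-resp (⊙-assoc a b x) k = ≋-reflexive (ℤ.*-assoc a b (ρ x k))
      ρ-resp (⊙-distribʳ a b x) k = ≋-reflexive (ℤ.*-distribʳ-+ (ρ x k) a b)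
      ρ-resp (⊙-distribˡ a x y) k = ≋-reflexive (ℤ.*-distribˡ-+ a (ρ x k) (ρ y k))
      ρ-resp (br-⊕ˡ x y z) k = ≋-reflexive (br-sl₂-+ˡ (ρ x) (ρ y) (ρ z) k)
      ρ-resp (br-⊕ʳ x y z) k = ≋-reflexive (br-sl₂-+ʳ (ρ x) (ρ y) (ρ z) k)
      ρ-resp (br-⊙ˡ a x y) k = ≋-reflexive (br-sl₂-*ˡ a (ρ x) (ρ y) k)
      ρ-resp (br-⊙ʳ a x y) k = ≋-reflexive (br-sl₂-*ʳ a (ρ x) (ρ y) k)
      ρ-resp (br-alt x) k = ≋-reflexive (br-sl₂-alt (ρ x) k)
      ρ-resp (jacobi x y z) k = ≋-reflexive (br-sl₂-jacobi (ρ x) (ρ y) (ρ z) k)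
      ρ-resp (rel i) k = ρ-rel i k

      embed-cong : ∀ {m v w} → (∀ k → v k ≋ w k) →
        ∀ i j → embed {m} v i j ≋ embed {m} w i j
      embed-cong v≋w 0F            0F            = v≋w 1F
      embed-cong v≋w 0F            1F            = v≋w 0F
      embed-cong v≋w 1F            0F            = v≋w 2F
      embed-cong v≋w 1F            1F            = neg-cong (v≋w 1F)
      embed-cong v≋w 0F            (suc (suc _)) = ≋-refl
      embed-cong v≋w 1F            (suc (suc _)) = ≋-refl
      embed-cong v≋w (suc (suc _)) _             = ≋-refl

      embed-ρ-isLieHom : ∀ m → IsLieHom (2 ℕ.+ m) (embed {m} ∘ ρ)
      embed-ρ-isLieHom m = record
        { resp   = λ {x} {y} x≈y i j → ≋⇒≡mod {embed (ρ x) i j} {embed (ρ y) i j}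
            (embed-cong (ρ-resp x≈y) i j)
        ; hom-⊕  = λ x y i j → ≡⇒≡mod (embed-+ (ρ x) (ρ y) i j)
        ; hom-⊙  = λ a x i j → ≡⇒≡mod (embed-* a (ρ x) i j)
        ; hom-br = λ x y i j → ≡⇒≡mod (embed-br {m} (ρ x) (ρ y) i j)
        }
        where
        ≡⇒≡mod : ∀ {a b} → a ≡ b → a ≡ b [mod p ]
        ≡⇒≡mod {a} {b} a≡b = ≋⇒≡mod {a} {b} (≋-reflexive a≡b)

  -- ξᵢ is sent to xᵢ Yᵢ, where Y₁ = E/2, Y₂ = F/2, Y₃ = (E + H - F)/2 in sl₂ (the scalar
  -- h is 1/2). These satisfy
  --   Y₁ = - [Y₁,Y₂] - [Y₁,Y₃],  Y₂ = [Y₁,Y₂] + [Y₂,Y₃],  Y₃ = - [Y₁,Y₃] - [Y₂,Y₃],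
  -- and the hypotheses on x turn these into the defining relations.
  module _
    (h : ℤ) (2h≋1 : h * + 2 ≋ 1ℤ) (x : Fin 3 → ℤ)
    (ℓ₁₂x₂≋c₁ : ℓ 0F 1F * x 1F ≋ c 0F) (ℓ₁₃x₃≋c₁ : ℓ 0F 2F * x 2F ≋ c 0F)
    (ℓ₂₁x₁≋c₂ : ℓ 1F 0F * x 0F ≋ c 1F) (ℓ₂₃x₃≋-c₂ : ℓ 1F 2F * x 2F ≋ - c 1F)
    (ℓ₃₁x₁≋-c₃ : ℓ 2F 0F * x 0F ≋ - c 2F) (ℓ₃₂x₂≋-c₃ : ℓ 2F 1F * x 1F ≋ - c 2F)
    where

    X : Fin 3 → Fin 3 → ℤ
    X 0F = vec₃ (x 0F * h) 0ℤ 0ℤ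
    X 1F = vec₃ 0ℤ 0ℤ (x 1F * h)
    X 2F = vec₃ (x 2F * h) (x 2F * h) (- (x 2F * h))

    open Evaluation X

    -- Row `i` lists the hypotheses bearing on the `i`-th relation as integers that vanish modulo
    -- `p`. Each coordinate of that relation is then certified as an integer combination of its row.
    residual : Fin 3 → Fin 3 → ℤ
    residual 0F = vec₃ (ℓ 0F 1F * x 1F - c 0F) (ℓ 0F 2F * x 2F - c 0F) (h * + 2 - 1ℤ)
    residual 1F = vec₃ (ℓ 1F 0F * x 0F - c 1F) (ℓ 1F 2F * x 2F - - c 1F) (h * + 2 - 1ℤ)
    residual 2F = vec₃ (ℓ 2F 0F * x 0F - - c 2F) (ℓ 2F 1F * x 1F - - c 2F) (h * + 2 - 1ℤ)

    residual≋0 : ∀ i j → residual i j ≋ 0ℤ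
    residual≋0 0F 0F = ≋⇒-≋0 ℓ₁₂x₂≋c₁
    residual≋0 0F 1F = ≋⇒-≋0 ℓ₁₃x₃≋c₁
    residual≋0 0F 2F = ≋⇒-≋0 2h≋1
    residual≋0 1F 0F = ≋⇒-≋0 ℓ₂₁x₁≋c₂
    residual≋0 1F 1F = ≋⇒-≋0 ℓ₂₃x₃≋-c₂
    residual≋0 1F 2F = ≋⇒-≋0 2h≋1
    residual≋0 2F 0F = ≋⇒-≋0 ℓ₃₁x₁≋-c₃
    residual≋0 2F 1F = ≋⇒-≋0 ℓ₃₂x₂≋-c₃
    residual≋0 2F 2F = ≋⇒-≋0 2h≋1

    private
      combination : ∀ i (w : Fin 3 → ℤ) {a} → a ≡ sum₃ (λ j → residual i j * w j) → a ≋ 0ℤ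
      combination i w a≡Σ =
        ≋-trans (≋-reflexive a≡Σ) (sum₃-*≋0 (residual i) w (residual≋0 i))

      -- In these nine identities `B` and `C` are coordinates of the two brackets in a relation. The
      -- cofactors on the right record two substitutions: products of a linking number and a scale
      -- become `c` or `- c`, then `h * + 2` becomes `1ℤ`.
      entry-00 : ∀ a b c h x₁ x₂ x₃ B C →
        B ≡ + 2 * (0ℤ * 0ℤ - 0ℤ * (x₁ * h)) → C ≡ + 2 * (0ℤ * (x₃ * h) - (x₃ * h) * (x₁ * h)) →
        c * (x₁ * h) + (0ℤ + a * B + b * C) ≡
        (a * x₂ + - c) * 0ℤ + (b * x₃ + - c) * (- (x₁ * h * (+ 2 * h))) + (h * + 2 + - 1ℤ) * (- (x₁ * h * c))
      entry-00 a b c h x₁ x₂ x₃ _ _ refl refl = solve (a ∷ b ∷ c ∷ h ∷ x₁ ∷ x₂ ∷ x₃ ∷ [])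

      entry-01 : ∀ a b c h x₁ x₂ x₃ B C →
        B ≡ ((x₁ * h) * (x₂ * h) - 0ℤ * 0ℤ) → C ≡ ((x₁ * h) * (- (x₃ * h)) - (x₃ * h) * 0ℤ) →
        c * 0ℤ + (0ℤ + a * B + b * C) ≡
        (a * x₂ + - c) * (x₁ * h * h) + (b * x₃ + - c) * (- (x₁ * h * h)) + (h * + 2 + - 1ℤ) * 0ℤ
      entry-01 a b c h x₁ x₂ x₃ _ _ refl refl = solve (a ∷ b ∷ c ∷ h ∷ x₁ ∷ x₂ ∷ x₃ ∷ [])

      entry-02 : ∀ a b c h x₁ x₂ x₃ B C →
        B ≡ + 2 * (0ℤ * 0ℤ - 0ℤ * (x₂ * h)) → C ≡ + 2 * ((x₃ * h) * 0ℤ - 0ℤ * (- (x₃ * h))) →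
        c * 0ℤ + (0ℤ + a * B + b * C) ≡
        (a * x₂ + - c) * 0ℤ + (b * x₃ + - c) * 0ℤ + (h * + 2 + - 1ℤ) * 0ℤ
      entry-02 a b c h x₁ x₂ x₃ _ _ refl refl = solve (a ∷ b ∷ c ∷ h ∷ x₁ ∷ x₂ ∷ x₃ ∷ [])

      entry-10 : ∀ a b c h x₁ x₂ x₃ B C →
        B ≡ + 2 * (0ℤ * (x₁ * h) - 0ℤ * 0ℤ) → C ≡ + 2 * (0ℤ * (x₃ * h) - (x₃ * h) * 0ℤ) →
        c * 0ℤ + (a * B + 0ℤ + b * C) ≡
        (a * x₁ + - c) * 0ℤ + (b * x₃ + - - c) * 0ℤ + (h * + 2 + - 1ℤ) * 0ℤ
      entry-10 a b c h x₁ x₂ x₃ _ _ refl refl = solve (a ∷ b ∷ c ∷ h ∷ x₁ ∷ x₂ ∷ x₃ ∷ [])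

      entry-11 : ∀ a b c h x₁ x₂ x₃ B C →
        B ≡ (0ℤ * 0ℤ - (x₁ * h) * (x₂ * h)) → C ≡ (0ℤ * (- (x₃ * h)) - (x₃ * h) * (x₂ * h)) →
        c * 0ℤ + (a * B + 0ℤ + b * C) ≡
        (a * x₁ + - c) * (- (x₂ * h * h)) + (b * x₃ + - - c) * (- (x₂ * h * h)) + (h * + 2 + - 1ℤ) * 0ℤ
      entry-11 a b c h x₁ x₂ x₃ _ _ refl refl = solve (a ∷ b ∷ c ∷ h ∷ x₁ ∷ x₂ ∷ x₃ ∷ [])

      entry-12 : ∀ a b c h x₁ x₂ x₃ B C →
        B ≡ + 2 * (0ℤ * (x₂ * h) - 0ℤ * 0ℤ) → C ≡ + 2 * ((x₃ * h) * (x₂ * h) - 0ℤ * (- (x₃ * h))) →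
        c * (x₂ * h) + (a * B + 0ℤ + b * C) ≡
        (a * x₁ + - c) * 0ℤ + (b * x₃ + - - c) * (x₂ * h * (+ 2 * h)) + (h * + 2 + - 1ℤ) * (- (x₂ * h * c))
      entry-12 a b c h x₁ x₂ x₃ _ _ refl refl = solve (a ∷ b ∷ c ∷ h ∷ x₁ ∷ x₂ ∷ x₃ ∷ [])

      entry-20 : ∀ a b c h x₁ x₂ x₃ B C →
        B ≡ + 2 * ((x₃ * h) * (x₁ * h) - 0ℤ * (x₃ * h)) → C ≡ + 2 * ((x₃ * h) * 0ℤ - 0ℤ * (x₃ * h)) →
        c * (x₃ * h) + (a * B + b * C + 0ℤ) ≡
        (a * x₁ + - - c) * (x₃ * h * (+ 2 * h)) + (b * x₂ + - - c) * 0ℤ + (h * + 2 + - 1ℤ) * (- (x₃ * h * c))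
      entry-20 a b c h x₁ x₂ x₃ _ _ refl refl = solve (a ∷ b ∷ c ∷ h ∷ x₁ ∷ x₂ ∷ x₃ ∷ [])

      entry-21 : ∀ a b c h x₁ x₂ x₃ B C →
        B ≡ ((x₃ * h) * 0ℤ - (x₁ * h) * (- (x₃ * h))) → C ≡ ((x₃ * h) * (x₂ * h) - 0ℤ * (- (x₃ * h))) →
        c * (x₃ * h) + (a * B + b * C + 0ℤ) ≡
        (a * x₁ + - - c) * (x₃ * h * h) + (b * x₂ + - - c) * (x₃ * h * h) + (h * + 2 + - 1ℤ) * (- (x₃ * h * c))
      entry-21 a b c h x₁ x₂ x₃ _ _ refl refl = solve (a ∷ b ∷ c ∷ h ∷ x₁ ∷ x₂ ∷ x₃ ∷ [])

      entry-22 : ∀ a b c h x₁ x₂ x₃ B C →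
        B ≡ + 2 * (0ℤ * (- (x₃ * h)) - (x₃ * h) * 0ℤ) → C ≡ + 2 * (0ℤ * (- (x₃ * h)) - (x₃ * h) * (x₂ * h)) →
        c * (- (x₃ * h)) + (a * B + b * C + 0ℤ) ≡
        (a * x₁ + - - c) * 0ℤ + (b * x₂ + - - c) * (- (x₃ * h * (+ 2 * h))) + (h * + 2 + - 1ℤ) * (x₃ * h * c)
      entry-22 a b c h x₁ x₂ x₃ _ _ refl refl = solve (a ∷ b ∷ c ∷ h ∷ x₁ ∷ x₂ ∷ x₃ ∷ [])

    ρ-rel : ∀ i k → ρ (linkRel c ℓ i) k ≋ 0ℤ
    ρ-rel 0F 0F = combination 0F (vec₃ 0ℤ (- (x 0F * h * (+ 2 * h))) (- (x 0F * h * c 0F)))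
      (entry-00 (ℓ 0F 1F) (ℓ 0F 2F) (c 0F) h (x 0F) (x 1F) (x 2F) _ _
        (br-sl₂-vec₃ (x 0F * h) 0ℤ 0ℤ 0ℤ 0ℤ (x 1F * h) 0F)
        (br-sl₂-vec₃ (x 0F * h) 0ℤ 0ℤ (x 2F * h) (x 2F * h) (- (x 2F * h)) 0F))
    ρ-rel 0F 1F = combination 0F (vec₃ (x 0F * h * h) (- (x 0F * h * h)) 0ℤ)
      (entry-01 (ℓ 0F 1F) (ℓ 0F 2F) (c 0F) h (x 0F) (x 1F) (x 2F) _ _
        (br-sl₂-vec₃ (x 0F * h) 0ℤ 0ℤ 0ℤ 0ℤ (x 1F * h) 1F)
        (br-sl₂-vec₃ (x 0F * h) 0ℤ 0ℤ (x 2F * h) (x 2F * h) (- (x 2F * h)) 1F))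
    ρ-rel 0F 2F = combination 0F (vec₃ 0ℤ 0ℤ 0ℤ)
      (entry-02 (ℓ 0F 1F) (ℓ 0F 2F) (c 0F) h (x 0F) (x 1F) (x 2F) _ _
        (br-sl₂-vec₃ (x 0F * h) 0ℤ 0ℤ 0ℤ 0ℤ (x 1F * h) 2F)
        (br-sl₂-vec₃ (x 0F * h) 0ℤ 0ℤ (x 2F * h) (x 2F * h) (- (x 2F * h)) 2F))
    ρ-rel 1F 0F = combination 1F (vec₃ 0ℤ 0ℤ 0ℤ)
      (entry-10 (ℓ 1F 0F) (ℓ 1F 2F) (c 1F) h (x 0F) (x 1F) (x 2F) _ _
        (br-sl₂-vec₃ 0ℤ 0ℤ (x 1F * h) (x 0F * h) 0ℤ 0ℤ 0F)
        (br-sl₂-vec₃ 0ℤ 0ℤ (x 1F * h) (x 2F * h) (x 2F * h) (- (x 2F * h)) 0F))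
    ρ-rel 1F 1F = combination 1F (vec₃ (- (x 1F * h * h)) (- (x 1F * h * h)) 0ℤ)
      (entry-11 (ℓ 1F 0F) (ℓ 1F 2F) (c 1F) h (x 0F) (x 1F) (x 2F) _ _
        (br-sl₂-vec₃ 0ℤ 0ℤ (x 1F * h) (x 0F * h) 0ℤ 0ℤ 1F)
        (br-sl₂-vec₃ 0ℤ 0ℤ (x 1F * h) (x 2F * h) (x 2F * h) (- (x 2F * h)) 1F))
    ρ-rel 1F 2F = combination 1F (vec₃ 0ℤ (x 1F * h * (+ 2 * h)) (- (x 1F * h * c 1F)))
      (entry-12 (ℓ 1F 0F) (ℓ 1F 2F) (c 1F) h (x 0F) (x 1F) (x 2F) _ _
        (br-sl₂-vec₃ 0ℤ 0ℤ (x 1F * h) (x 0F * h) 0ℤ 0ℤ 2F)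
        (br-sl₂-vec₃ 0ℤ 0ℤ (x 1F * h) (x 2F * h) (x 2F * h) (- (x 2F * h)) 2F))
    ρ-rel 2F 0F = combination 2F (vec₃ (x 2F * h * (+ 2 * h)) 0ℤ (- (x 2F * h * c 2F)))
      (entry-20 (ℓ 2F 0F) (ℓ 2F 1F) (c 2F) h (x 0F) (x 1F) (x 2F) _ _
        (br-sl₂-vec₃ (x 2F * h) (x 2F * h) (- (x 2F * h)) (x 0F * h) 0ℤ 0ℤ 0F)
        (br-sl₂-vec₃ (x 2F * h) (x 2F * h) (- (x 2F * h)) 0ℤ 0ℤ (x 1F * h) 0F))
    ρ-rel 2F 1F = combination 2F (vec₃ (x 2F * h * h) (x 2F * h * h) (- (x 2F * h * c 2F)))
      (entry-21 (ℓ 2F 0F) (ℓ 2F 1F) (c 2F) h (x 0F) (x 1F) (x 2F) _ _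
        (br-sl₂-vec₃ (x 2F * h) (x 2F * h) (- (x 2F * h)) (x 0F * h) 0ℤ 0ℤ 1F)
        (br-sl₂-vec₃ (x 2F * h) (x 2F * h) (- (x 2F * h)) 0ℤ 0ℤ (x 1F * h) 1F))
    ρ-rel 2F 2F = combination 2F (vec₃ 0ℤ (- (x 2F * h * (+ 2 * h))) (x 2F * h * c 2F))
      (entry-22 (ℓ 2F 0F) (ℓ 2F 1F) (c 2F) h (x 0F) (x 1F) (x 2F) _ _
        (br-sl₂-vec₃ (x 2F * h) (x 2F * h) (- (x 2F * h)) (x 0F * h) 0ℤ 0ℤ 2F)
        (br-sl₂-vec₃ (x 2F * h) (x 2F * h) (- (x 2F * h)) 0ℤ 0ℤ (x 1F * h) 2F))

    -- The entry at `0F 1F` is the E-coordinate of the image of `ξ 0F`.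
    FM⇒x₁h≋0 : ∀ m → FM (2 ℕ.+ m) → x 0F * h ≋ 0ℤ
    FM⇒x₁h≋0 m fm =
      ≡mod⇒≋ {x 0F * h} {0ℤ} (fm (embed ∘ ρ) (embed-ρ-isLieHom ρ-rel m) (ξ 0F) 0F 1F)

  -- If the representation were zero, its scale `x₁` would vanish, and with it `c 1F`, which is
  -- `ℓ 1F 0F * x₁` modulo `p`.
  criterion⇒¬FM : p ≢ 2 → (∀ i → ¬ c i ≋ 0ℤ) → RepresentationCriterion p c ℓ →
    ∀ m → ¬ FM (2 ℕ.+ m)
  criterion⇒¬FM p≢2 c≄0 (ℓ≢0 , rel₁₃ , rel₂₁ , rel₁₂) m fm = c≄0 1F (begin
    c 1F           ≈⟨ ℓ₂₁x₁≋c₂ ⟨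
    ℓ 1F 0F * x₁   ≈⟨ *-≋0ˡ (ℓ 1F 0F) x₁≋0 ⟩
    0ℤ             ∎)
    where
    open SetoidReasoning ≋-setoid

    2≄0 : ¬ + 2 ≋ 0ℤ
    2≄0 2≋0 with irreducible[2] (≋0⇒∣ 2≋0)
    ... | inj₁ p≡1 = p≢1 p≡1
    ... | inj₂ p≡2 = p≢2 p≡2

    ℓ₁₂≄0 : ¬ ℓ 0F 1F ≋ 0ℤ
    ℓ₁₂≄0 = ℓ≢0 0F 1F (λ ()) ∘ ≋⇒≡mod {b = 0ℤ}
    ℓ₁₃≄0 : ¬ ℓ 0F 2F ≋ 0ℤ
    ℓ₁₃≄0 = ℓ≢0 0F 2F (λ ()) ∘ ≋⇒≡mod {b = 0ℤ}
    ℓ₂₁≄0 : ¬ ℓ 1F 0F ≋ 0ℤ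
    ℓ₂₁≄0 = ℓ≢0 1F 0F (λ ()) ∘ ≋⇒≡mod {b = 0ℤ}

    h x₁ x₂ x₃ : ℤ
    -- Each scale is determined by one of its two equations; `cross-quotient` derives the other from
    -- the criterion.
    h  = proj₁ (inverse (+ 2) 2≄0)
    x₁ = proj₁ (quotient (ℓ 1F 0F) (c 1F) ℓ₂₁≄0)
    x₂ = proj₁ (quotient (ℓ 0F 1F) (c 0F) ℓ₁₂≄0)
    x₃ = proj₁ (quotient (ℓ 0F 2F) (c 0F) ℓ₁₃≄0)

    2h≋1 : h * + 2 ≋ 1ℤ
    2h≋1 = proj₂ (inverse (+ 2) 2≄0)
    ℓ₂₁x₁≋c₂ : ℓ 1F 0F * x₁ ≋ c 1F
    ℓ₂₁x₁≋c₂ = proj₂ (quotient (ℓ 1F 0F) (c 1F) ℓ₂₁≄0)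
    ℓ₁₂x₂≋c₁ : ℓ 0F 1F * x₂ ≋ c 0F
    ℓ₁₂x₂≋c₁ = proj₂ (quotient (ℓ 0F 1F) (c 0F) ℓ₁₂≄0)
    ℓ₁₃x₃≋c₁ : ℓ 0F 2F * x₃ ≋ c 0F
    ℓ₁₃x₃≋c₁ = proj₂ (quotient (ℓ 0F 2F) (c 0F) ℓ₁₃≄0)

    x₁h≋0 : x₁ * h ≋ 0ℤ
    x₁h≋0 = FM⇒x₁h≋0 h 2h≋1 (vec₃ x₁ x₂ x₃) ℓ₁₂x₂≋c₁ ℓ₁₃x₃≋c₁ ℓ₂₁x₁≋c₂
      (cross-quotient (ℓ 0F 2F) (ℓ 1F 2F) (c 0F) (c 1F) x₃ ℓ₁₃≄0 ℓ₁₃x₃≋c₁ (≡mod⇒≋ rel₁₃))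
      (cross-quotient (ℓ 1F 0F) (ℓ 2F 0F) (c 1F) (c 2F) x₁ ℓ₂₁≄0 ℓ₂₁x₁≋c₂ (≡mod⇒≋ rel₂₁))
      (cross-quotient (ℓ 0F 1F) (ℓ 2F 1F) (c 0F) (c 2F) x₂ ℓ₁₂≄0 ℓ₁₂x₂≋c₁ (≡mod⇒≋ rel₁₂))
      m fm

    x₁≋0 : x₁ ≋ 0ℤ
    x₁≋0 = begin
      x₁               ≡⟨ ℤ.*-identityʳ x₁ ⟨
      x₁ * 1ℤ          ≈⟨ *-congˡ x₁ 2h≋1 ⟨
      x₁ * (h * + 2)   ≡⟨ ℤ.*-assoc x₁ h (+ 2) ⟨
      x₁ * h * + 2     ≈⟨ *-≋0ʳ (+ 2) x₁h≋0 ⟩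
      0ℤ               ∎

-- Specialisation to the linking data of three primes.

theorem1p7 :
  (p : ℕ) → Prime p → p ≢ 2 →
  (q : Fin 3 → ℕ) → (∀ i → Prime (q i)) → Injective _≡_ _≡_ q →
  (∀ i → p ∣ q i ∸ 1) → (∀ i → ¬ (p ^ 2 ∣ q i ∸ 1)) →
  (c : Fin 3 → ℕ) → (∀ i → q i ∸ 1 ≡ c i Data.Nat.* p) →
  (g : Fin 3 → ℕ) → (∀ j → IsPrimitiveRoot (q j) (g j)) →
  (L : Fin 3 → Fin 3 → ℕ) →
  (∀ i j → i ≢ j → (q i Data.Nat.* g j ^ L i j) ≡ℕ 1 [mod q j ]) →
  (n : ℕ) → 2 ≤ n → n < p →
  let cz : Fin 3 → ℤ
      cz i = + c i
      ℓ : Fin 3 → Fin 3 → ℤ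
      ℓ i j = + L i j
      i1 = zero
      i2 = suc zero
      i3 = suc (suc zero)
  in (¬ LinkingAlgebra.FM p cz ℓ n) ⇔
     ((∀ i j → i ≢ j → ¬ (ℓ i j ≡ + 0 [mod p ])) ×
      (ℓ i1 i3 * cz i2 ≡ - (ℓ i2 i3 * cz i1) [mod p ]) ×
      (ℓ i2 i1 * cz i3 ≡ - (ℓ i3 i1 * cz i2) [mod p ]) ×
      (ℓ i1 i2 * cz i3 ≡ - (ℓ i3 i2 * cz i1) [mod p ]))
-- Matching on `2 ≤ n` writes `n` as `2 + m`, which leaves room for the two-dimensional block of
-- sl₂.
theorem1p7 p p-prime p≢2 q _ _ _ p²∤q-1 c q-1≡cp _ _ L _ (suc (suc m)) (ℕ.s≤s (ℕ.s≤s ℕ.z≤n)) _ =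
  mk⇔ (LinkingModule.¬FM⇒criterion p p-prime cz ℓ c≄0 (2 ℕ.+ m))
      (λ criterion → Representation.criterion⇒¬FM p p-prime cz ℓ p≢2 c≄0 criterion m)
  where
  cz : Fin 3 → ℤ
  cz i = + c i

  ℓ : Fin 3 → Fin 3 → ℤ
  ℓ i j = + L i j

  open PrimeField p p-prime

  -- If `p` divided `c i`, then `p ^ 2` would divide `c i * p`, that is `q i ∸ 1`. The inner
  -- rewriting is there because `p ^ 2` unfolds to `p * (p * 1)`.
  c≄0 : ∀ i → ¬ cz i ≋ 0ℤ
  c≄0 i cᵢ≋0 = p²∤q-1 i (subst (p ^ 2 ∣_) (sym (q-1≡cp i))
    (subst (_∣ c i ℕ.* p) (sym (cong (p ℕ.*_) (ℕ.*-identityʳ p))) (ℕD.*-monoˡ-∣ p (≋0⇒∣ cᵢ≋0))))
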